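{- Every $d$-dimensional extremal $(0,1)$-matrix of order $n$ with deficiency $1$ or $\tfrac12$ is diagonally extremal.
   Context: A $d$-dimensional matrix of order $n$ is an array $(a_\alpha)_{\alpha\in\{1,\dots,n\}^d}$; $\mathrm{supp}(A)=\{\alpha:a_\alpha\ne0\}$; the hyperplane $\Gamma_{i,j}$ is the set of indices with $\alpha_i=j$. For an index $\alpha$, $A_\alpha$ is the submatrix of order $n-1$ obtained from $A$ by deleting all hyperplanes containing $\alpha$. A polyplex of weight $W$ is a nonnegative matrix $K$ whose entries sum to at most $1$ over each hyperplane and to $W$ in total; a polydiagonal in a matrix of order $m$ is a polyplex of weight $m$; a diagonal is a $(0,1)$-matrix with exactly one unit entry in each hyperplane. A $(0,1)$-matrix $A$ contains $K$ if $\mathrm{supp}(K)\subseteq\mathrm{supp}(A)$. A $(0,1)$-matrix $A$ is extremal if it contains no polydiagonal, but for every $\alpha$ with $a_\alpha=0$ the matrix obtained by changing $a_\alpha$ to $1$ contains a polydiagonal; it is diagonally extremal if it contains no polydiagonal and for every $\alpha$ with $a_\alpha=0$ the submatrix $A_\alpha$ contains a diagonal. The deficiency of an extremal matrix of order $n$ is $n$ minus the maximum weight of a polyplex it contains.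
   Formalization: Polyplexes and polydiagonals have nonnegative rational entries instead of real ones, in the definitions of extremal, diagonally extremal and deficiency; since all constraints are linear with rational coefficients, these notions agree with the real ones. -}

module Defs where

open import Data.Nat using (ℕ; zero; suc)
open import Data.Fin using (Fin; punchIn; _≟_)
open import Data.Fin.Properties using (all?)
open import Data.Bool using (Bool; true; false; if_then_else_)
open import Data.Integer using (+_)
open import Data.Rational using (ℚ; 0ℚ; 1ℚ; _+_; _-_; _≤_; _/_)
open import Data.Vec.Functional using (_∷_)
open import Data.Product using (Σ; ∃; _×_; _,_)
open import Relation.Binary.PropositionalEquality using (_≡_; _≢_)
open import Relation.Nullary using (¬_)
open import Relation.Nullary.Decidable using (⌊_⌋)

Index : ℕ → ℕ → Set
Index d n = Fin d → Fin n

-- Real-valued matrices are represented with rational entries.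
QMatrix : ℕ → ℕ → Set
QMatrix d n = Index d n → ℚ

Matrix01 : ℕ → ℕ → Set
Matrix01 d n = Index d n → Bool

sumFin : (n : ℕ) → (Fin n → ℚ) → ℚ
sumFin zero    f = 0ℚ
sumFin (suc n) f = f Fin.zero + sumFin n (λ j → f (Fin.suc j))

sumIdx : (d n : ℕ) → (Index d n → ℚ) → ℚ
sumIdx zero    n f = f (λ ())
sumIdx (suc d) n f = sumFin n (λ j → sumIdx d n (λ β → f (j ∷ β)))

total : {d n : ℕ} → QMatrix d n → ℚ
total {d} {n} K = sumIdx d n K

hypSum : {d n : ℕ} → QMatrix d n → Fin d → Fin n → ℚ
hypSum {d} {n} K i j = sumIdx d n (λ α → if ⌊ α i ≟ j ⌋ then K α else 0ℚ)

ℕtoℚ : ℕ → ℚ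
ℕtoℚ n = + n / 1

IsPolyplex : {d n : ℕ} → QMatrix d n → ℚ → Set
IsPolyplex K W =
  (∀ α → 0ℚ ≤ K α) × (∀ i j → hypSum K i j ≤ 1ℚ) × (total K ≡ W)

IsPolydiagonal : {d n : ℕ} → QMatrix d n → Set
IsPolydiagonal {d} {n} K = IsPolyplex K (ℕtoℚ n)

Contains : {d n : ℕ} → Matrix01 d n → QMatrix d n → Set
Contains A K = ∀ α → K α ≢ 0ℚ → A α ≡ true

ContainsPolydiagonal : {d n : ℕ} → Matrix01 d n → Set
ContainsPolydiagonal A = ∃ λ K → IsPolydiagonal K × Contains A K

setOne : {d n : ℕ} → Matrix01 d n → Index d n → Matrix01 d n
setOne A α β = if ⌊ all? (λ k → β k ≟ α k) ⌋ then true else A β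

IsExtremal : {d n : ℕ} → Matrix01 d n → Set
IsExtremal A =
  ¬ ContainsPolydiagonal A × (∀ α → A α ≡ false → ContainsPolydiagonal (setOne A α))

HasDeficiency : {d n : ℕ} → Matrix01 d n → ℚ → Set
HasDeficiency {d} {n} A δ =
  (∃ λ K → IsPolyplex K (ℕtoℚ n - δ) × Contains A K) ×
  (∀ K W → IsPolyplex K W → Contains A K → W ≤ ℕtoℚ n - δ)

IsDiagonal : {d n : ℕ} → Matrix01 d n → Set
IsDiagonal D =
  ∀ i j → Σ _ λ α → (α i ≡ j) × (D α ≡ true) ×
            (∀ β → β i ≡ j → D β ≡ true → ∀ k → β k ≡ α k)

Contains01 : {d n : ℕ} → Matrix01 d n → Matrix01 d n → Set
Contains01 A D = ∀ α → D α ≡ true → A α ≡ true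

ContainsDiagonal : {d n : ℕ} → Matrix01 d n → Set
ContainsDiagonal A = ∃ λ D → IsDiagonal D × Contains01 A D

-- A_α : delete all hyperplanes containing α (order n−1)
sub : {d m : ℕ} → Matrix01 d (suc m) → Index d (suc m) → Matrix01 d m
sub A α β = A (λ i → punchIn (α i) (β i))

IsDiagonallyExtremal : {d m : ℕ} → Matrix01 d (suc m) → Set
IsDiagonallyExtremal A =
  ¬ ContainsPolydiagonal A × (∀ α → A α ≡ false → ContainsDiagonal (sub A α))

{-# OPTIONS --safe #-}
module Submission where

-- By linear programming duality (Farkas' lemma, by Fourier-Motzkin elimination) the maximum weight n - δ
-- of a polyplex in A is also the weight of a fractional cover λ: hyperplane weights with λ(α) ≥ 1 on the
-- ones of A. Extremality gives λ(α) ≤ 1 - δ on the zeros. For δ ∈ {1, ½} this gap forces λ, after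
-- subtracting from each direction its minimum, to act like a cover with weights in {0, ½, 1}: A has a one
-- at α exactly when α meets a hyperplane of weight 1 ("full") or two of weight ½ ("half"). Given a zero α,
-- an index of a diagonal of A_α needs one full or two halves in different directions. There are enough of
-- them, and no direction has more than half of the halves (otherwise dropping its halves and doubling the
-- others would give a lighter cover), so a diagonal can be chosen greedily.

open import Defs
open import Data.Bool using (true; false; if_then_else_)
open import Data.Empty using (⊥-elim)
open import Data.Fin using (Fin; zero; suc; _≟_; combine; remQuot; punchIn; punchOut; _↑ˡ_; _↑ʳ_)
open import Data.Fin.Properties
  using (all?; any?; remQuot-combine; suc-injective; punchIn-punchOut; punchInᵢ≢i; punchIn-injective)
import Data.Integer as ℤ
import Data.Integer.Properties as ℤ
open import Data.List using (List; []; _∷_; _++_; map; cartesianProductWith; allFin)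
open import Data.List.Membership.Propositional using (_∈_)
open import Data.List.Membership.Propositional.Properties using (∈-cartesianProductWith⁺; ∈-allFin)
open import Data.List.Relation.Unary.All as All using (All; []; _∷_)
import Data.List.Relation.Unary.All.Properties as All
open import Data.List.Relation.Unary.Any using (here)
open import Data.Nat as ℕ using (ℕ; zero; suc)
import Data.Nat.Coprimality as Coprime
import Data.Nat.Properties as ℕ
open import Algebra.Properties.CommutativeMonoid.Sum ℕ.+-0-commutativeMonoid
  using (sum; sum-remove; ∑-distrib-+; sum-cong-≗; sum-replicate-zero)
open import Data.Product using (∃; ∃₂; _×_; _,_; proj₁; proj₂)
open import Data.Sum using (_⊎_; inj₁; inj₂)
open import Data.Vec.Functional using (removeAt) renaming (_∷_ to _∷ᶠ_)
open import Function using (_∘_)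
open import Relation.Binary.Bundles using (DecTotalOrder)
open import Relation.Binary.Definitions using (tri<; tri≈; tri>)
open import Relation.Binary.PropositionalEquality
open import Relation.Nullary using (¬_; Dec; yes; no)
open import Relation.Nullary.Decidable using (⌊_⌋; from-yes)

-- Ones of A weigh at least 1 and zeros at most 1 - δ ≤ ½, so columns that are light one by one
-- cannot add up across the gap. The obstacle is that linear programming yields only a rational
-- cover, part of whose weight may sit as a constant in all columns of a direction. With c the sum
-- of these constants, a full column need only have weight 1 - c above them; rounding it up to 1 can
-- enlarge the table by a factor 1 / (1 - c). The weight n c saved by dropping the constants pays
-- for this. After the rounding, duality is needed only in its weak form, against integral tables: a
-- maximum polyplex bounds every cover from below, and this is applied to the rounded table and to
-- its variant with doubled halves.

private variable d k m n : ℕ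

-- Without function extensionality an index has many pointwise equal copies, of which sumIdx sees only
-- the canonical one.
canon : Index d n → Index d n
canon {zero}  α = λ ()
canon {suc d} α = α zero ∷ᶠ canon (α ∘ suc)

canon-≗ : (α : Index d n) → canon α ≗ α
canon-≗ {suc d} α zero    = refl
canon-≗ {suc d} α (suc i) = canon-≗ (α ∘ suc) i

canon-cong : {α β : Index d n} → α ≗ β → canon α ≡ canon β
canon-cong {zero}  α≗β = refl
canon-cong {suc d} α≗β = cong₂ _∷ᶠ_ (α≗β zero) (canon-cong (α≗β ∘ suc))

-- Finite sums of natural numbers

module _ where
  open import Data.Nat using (_+_; _≤_; _<_; z≤n; s≤s; s<s⁻¹; s≤s⁻¹)
  open import Data.Nat.Solver using (module +-*-Solver)
  open import Data.List.Extrema ℕ.≤-totalOrder using (argmax; f[xs]≤f[argmax])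
  open +-*-Solver using (solve; _:=_; _:+_; con)

  -- The common form of the linear estimates: the known inequality and the wanted one differ by an
  -- identity, which is left to a ring solver.
  ≤-by-balanceℕ : ∀ {p q r s} → p ≤ q → q + r ≡ p + s → r ≤ s
  ≤-by-balanceℕ {p} {q} {r} {s} p≤q eq = ℕ.+-cancelˡ-≤ p r s (begin
    p + r ≤⟨ ℕ.+-monoˡ-≤ r p≤q ⟩
    q + r ≡⟨ eq ⟩
    p + s ∎)
    where open ℕ.≤-Reasoning

  term≤sum : (f : Fin n → ℕ) → ∀ i → f i ≤ sum f
  term≤sum {suc n} f i = subst (f i ≤_) (sym (sum-remove f)) (ℕ.m≤m+n (f i) _)

  sum-split : (f : Fin (suc n) → ℕ) → ∀ {i j} (i≢j : i ≢ j) →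
              sum f ≡ f i + sum (removeAt f i) × removeAt f i (punchOut i≢j) ≡ f j
  sum-split f i≢j = sum-remove f , cong f (punchIn-punchOut i≢j)

  two-terms≤sum : (f : Fin n → ℕ) → ∀ {i j} → i ≢ j → f i + f j ≤ sum f
  two-terms≤sum {suc n} f {i} i≢j with sum-split f i≢j
  ... | sum≡ , at = subst₂ _≤_ (cong (f i +_) at) (sym sum≡)
                      (ℕ.+-monoʳ-≤ (f i) (term≤sum (removeAt f i) (punchOut i≢j)))

  sum-zero : (f : Fin n → ℕ) → (∀ i → f i ≡ 0) → sum f ≡ 0
  sum-zero {n} f f≡0 = trans (sum-cong-≗ f≡0) (sum-replicate-zero n)

  sum-single : (f : Fin n → ℕ) → ∀ i → (∀ j → j ≢ i → f j ≡ 0) → sum f ≡ f i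
  sum-single {suc n} f i off = trans (sum-remove f)
    (trans (cong (f i +_) (sum-zero (removeAt f i) (λ j → off _ (punchInᵢ≢i i j)))) (ℕ.+-identityʳ (f i)))

  sum-pair : (f : Fin n → ℕ) → ∀ {i j} → i ≢ j → (∀ l → l ≢ i → l ≢ j → f l ≡ 0) → sum f ≡ f i + f j
  sum-pair {suc n} f {i} {j} i≢j off with sum-split f i≢j
  ... | sum≡ , at = trans sum≡ (cong (f i +_) (trans
    (sum-single (removeAt f i) (punchOut i≢j) λ l l≢ → off _ (punchInᵢ≢i i l)
      λ eq → l≢ (punchIn-injective i _ _ (trans eq (sym (punchIn-punchOut i≢j))))) at))

  -- Zeroing a term, unlike `removeAt`, keeps the index type, so directions keep their names.
  without : (Fin n → ℕ) → Fin n → Fin n → ℕ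
  without f i j = if ⌊ j ≟ i ⌋ then 0 else f j

  without-self : (f : Fin n → ℕ) → ∀ i → without f i i ≡ 0
  without-self f i with i ≟ i
  ... | yes _  = refl
  ... | no i≢i = ⊥-elim (i≢i refl)

  without-other : (f : Fin n → ℕ) → ∀ {i j} → j ≢ i → without f i j ≡ f j
  without-other f {i} {j} j≢i with j ≟ i
  ... | yes j≡i = ⊥-elim (j≢i j≡i)
  ... | no _    = refl

  sum-without : (f : Fin n → ℕ) → ∀ i → sum f ≡ f i + sum (without f i)
  sum-without {suc n} f i = trans (sum-remove f) (cong (f i +_) (sym (trans (sum-remove (without f i))
    (cong₂ _+_ (without-self f i) (sum-cong-≗ (λ j → without-other f (punchInᵢ≢i i j)))))))

  positive-term : (f : Fin n → ℕ) → 0 < sum f → ∃ λ i → 0 < f i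
  positive-term {suc n} f 0<sum with f zero in eq
  ... | suc _ = zero , subst (0 <_) (sym eq) (s≤s z≤n)
  ... | zero  = let (i , 0<fi) = positive-term (f ∘ suc) 0<sum in suc i , 0<fi

  zero-term : (f : Fin n → ℕ) → sum f < n → ∃ λ i → f i ≡ 0
  zero-term {suc n} f sum<n with f zero in eq
  ... | zero  = zero , eq
  ... | suc x = let (i , fi≡0) = zero-term (f ∘ suc) (ℕ.≤-<-trans (ℕ.m≤n+m _ x) (s<s⁻¹ sum<n)) in suc i , fi≡0

  sum≤n : (f : Fin n → ℕ) → (∀ i → f i ≤ 1) → sum f ≤ n
  sum≤n {zero}  f f≤1 = z≤n
  sum≤n {suc n} f f≤1 = ℕ.+-mono-≤ (f≤1 zero) (sum≤n (f ∘ suc) (f≤1 ∘ suc))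

  abstract
    maximiser : (f : Fin (suc n) → ℕ) → ∃ λ i → ∀ j → f j ≤ f i
    maximiser f = argmax f zero (allFin _) ,
      λ j → All.lookup (f[xs]≤f[argmax] {f = f} zero (allFin _)) (∈-allFin j)

  ∑∑-distrib-+ : (f g : Fin k → Fin n → ℕ) →
    sum (λ i → sum (λ j → f i j + g i j)) ≡ sum (λ i → sum (f i)) + sum (λ i → sum (g i))
  ∑∑-distrib-+ f g = trans (sum-cong-≗ (λ i → ∑-distrib-+ (f i) (g i)))
    (∑-distrib-+ (λ i → sum (f i)) (λ i → sum (g i)))

  -- Tables of scores and their counts

  data Score : Set where
    none half full : Score

  isHalf isFull value : Score → ℕ
  isHalf none = 0
  isHalf half = 1
  isHalf full = 0
  isFull none = 0
  isFull half = 0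
  isFull full = 1
  value s = isFull s + isFull s + isHalf s

  isHalf≤1 : ∀ s → isHalf s ≤ 1
  isHalf≤1 none = z≤n
  isHalf≤1 half = ℕ.≤-refl
  isHalf≤1 full = z≤n

  0<isFull : ∀ {s} → 0 < isFull s → s ≡ full
  0<isFull {full} _ = refl

  0<isHalf : ∀ {s} → 0 < isHalf s → s ≡ half
  0<isHalf {half} _ = refl

  none-if : ∀ {s} → isFull s + isHalf s ≡ 0 → s ≡ none
  none-if {none} _ = refl

  Scores : ℕ → ℕ → Set
  Scores d n = Fin d → Fin n → Score

  count : (Score → ℕ) → Scores d n → Fin d → ℕ
  count μ S i = sum (μ ∘ S i)

  countTotal : (Score → ℕ) → Scores d n → ℕ
  countTotal μ S = sum (count μ S)

  countAt : (Score → ℕ) → Scores d n → Index d n → ℕ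
  countAt μ S α = sum (λ i → μ (S i (α i)))

  delete : Scores d (suc m) → Index d (suc m) → Scores d m
  delete S α i j = S i (punchIn (α i) j)

  count-delete : ∀ μ (S : Scores d (suc m)) α i → count μ S i ≡ μ (S i (α i)) + count μ (delete S α) i
  count-delete μ S α i = sum-remove (μ ∘ S i)

  countTotal-delete : ∀ μ (S : Scores d (suc m)) α →
                      countTotal μ S ≡ countAt μ S α + countTotal μ (delete S α)
  countTotal-delete μ S α = trans (sum-cong-≗ (count-delete μ S α))
    (∑-distrib-+ (λ i → μ (S i (α i))) (count μ (delete S α)))

  countAt-value : (S : Scores d n) → ∀ α →
    countAt value S α ≡ countAt isFull S α + countAt isFull S α + countAt isHalf S α
  countAt-value S α = trans (∑-distrib-+ (λ i → isFull (S i (α i)) + isFull (S i (α i))) (λ i → isHalf (S i (α i))))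
    (cong (_+ countAt isHalf S α) (∑-distrib-+ (λ i → isFull (S i (α i))) (λ i → isFull (S i (α i)))))

  -- A row is read as a table with one direction per column, in which the identity picks every entry
  -- once.
  count-value : (S : Scores d n) → ∀ i →
    count value S i ≡ count isFull S i + count isFull S i + count isHalf S i
  count-value S i = countAt-value (λ j _ → S i j) (λ j → j)

  countTotal-value : (S : Scores d n) →
    countTotal value S ≡ countTotal isFull S + countTotal isFull S + countTotal isHalf S
  countTotal-value S = trans (sum-cong-≗ (count-value S))
    (trans (∑-distrib-+ (λ i → count isFull S i + count isFull S i) (count isHalf S))
           (cong (_+ countTotal isHalf S) (∑-distrib-+ (count isFull S) (count isFull S))))

  noneColumn : (S : Scores d n) → ∀ i → count isFull S i + count isHalf S i < n → ∃ λ j → S i j ≡ none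
  noneColumn S i few with zero-term (λ j → isFull (S i j) + isHalf (S i j))
    (subst (_< _) (sym (∑-distrib-+ (isFull ∘ S i) (isHalf ∘ S i))) few)
  ... | j , eq = j , none-if eq

  -- Diagonals as families of indices

  -- Injectivity gives the uniqueness in `IsDiagonal` and surjectivity the existence; the inductive
  -- construction delivers both without a pigeonhole argument.
  record Diagonal (P : Index d n → Set) : Set where
    field
      row        : Fin n → Index d n
      good       : ∀ r → P (row r)
      injective  : ∀ i {r r′} → row r i ≡ row r′ i → r ≡ r′
      surjective : ∀ i j → ∃ λ r → row r i ≡ j

  emptyDiagonal : {P : Index d 0 → Set} → Diagonal P
  emptyDiagonal = record { row = λ () ; good = λ () ; injective = λ { i {()} } ; surjective = λ _ () }

  extendDiagonal : {P : Index d (suc m) → Set} (α : Index d (suc m)) → P α →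
                   Diagonal (λ β → P (λ i → punchIn (α i) (β i))) → Diagonal P
  extendDiagonal {d} {m} {P} α Pα diag =
    record { row = row ; good = good ; injective = injective ; surjective = surjective }
    where
    module D = Diagonal diag
    row : Fin (suc m) → Index d (suc m)
    row zero    = α
    row (suc r) = λ i → punchIn (α i) (D.row r i)
    good : ∀ r → P (row r)
    good zero    = Pα
    good (suc r) = D.good r
    injective : ∀ i {r r′} → row r i ≡ row r′ i → r ≡ r′
    injective i {zero}  {zero}   eq = refl
    injective i {zero}  {suc r′} eq = ⊥-elim (punchInᵢ≢i (α i) (D.row r′ i) (sym eq))
    injective i {suc r} {zero}   eq = ⊥-elim (punchInᵢ≢i (α i) (D.row r i) eq)
    injective i {suc r} {suc r′} eq = cong suc (D.injective i (punchIn-injective (α i) _ _ eq))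
    surjective : ∀ i j → ∃ λ r → row r i ≡ j
    surjective i j with α i ≟ j
    ... | yes αi≡j = zero , αi≡j
    ... | no  αi≢j = let (r , eq) = D.surjective i (punchOut αi≢j)
                     in suc r , trans (cong (punchIn (α i)) eq) (punchIn-punchOut αi≢j)

  -- Greedy choice of heavy indices

  Heavy : Scores d n → Index d n → Set
  Heavy S α = 2 ≤ countAt value S α

  -- The invariant of the greedy choice. If H fulls serve one index each, n - H indices remain, and
  -- each takes at most one half from any direction; `spread` says that no direction has more halves
  -- than that.
  record Balanced (S : Scores d n) : Set where
    field
      enough : n + n ≤ countTotal value S
      spread : ∀ i → count isHalf S i + countTotal isFull S ≤ n

  record HeavyStep (S : Scores d (suc m)) : Set where
    field
      α        : Index d (suc m)
      heavy    : Heavy S α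
      balanced : Balanced (delete S α)

  -- Spending one full and no half lowers the total value by 2 and the left side of `spread` by 1 in
  -- every direction, which is what the passage from n to n - 1 requires.
  step-full : (S : Scores d (suc m)) → Balanced S → 0 < countTotal isFull S → HeavyStep S
  step-full {d} {m} S bal 0<full = record
    { α = α
    ; heavy = subst (2 ≤_) (sym (trans (countAt-value S α) (cong₂ (λ f h → f + f + h) full≡1 half≡0))) ℕ.≤-refl
    ; balanced = record
      { enough = ≤-by-balanceℕ enough (trans
          (cong (_+ (m + m)) (trans (countTotal-delete value S α) (cong (_+ V′) value≡2)))
          (solve 2 (λ m v → (con 2 :+ v) :+ (m :+ m) := ((con 1 :+ m) :+ (con 1 :+ m)) :+ v) refl m V′))
      ; spread = λ i → ≤-by-balanceℕ (spread i) (trans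
          (solve 3 (λ m h f → (con 1 :+ m) :+ (h :+ f) := (h :+ (con 1 :+ f)) :+ m) refl
             m (count isHalf (delete S α) i) (countTotal isFull (delete S α)))
          (cong (_+ m) (sym (cong₂ _+_
            (trans (count-delete isHalf S α i) (cong (_+ count isHalf (delete S α) i) (α-half i)))
            (trans (countTotal-delete isFull S α) (cong (_+ countTotal isFull (delete S α)) full≡1))))))
      }
    }
    where
    open Balanced bal
    found = positive-term (count isFull S) 0<full
    i₀ = proj₁ found
    found′ = positive-term (isFull ∘ S i₀) (proj₂ found)
    choose : ∀ i → ∃ λ j → (i ≡ i₀ × S i j ≡ full) ⊎ (i ≢ i₀ × S i j ≡ none)
    choose i with i ≟ i₀
    ... | yes refl = proj₁ found′ , inj₁ (refl , 0<isFull (proj₂ found′))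
    ... | no i≢i₀  = let (j , eq) = noneColumn S i few in j , inj₂ (i≢i₀ , eq)
      where
      -- `spread i` also counts the full in row `i₀`, so row i itself has a column to spare.
      few : count isFull S i + count isHalf S i < suc m
      few = begin-strict
        count isFull S i + count isHalf S i                        ≡⟨ ℕ.+-comm (count isFull S i) _ ⟩
        count isHalf S i + count isFull S i
          <⟨ ℕ.+-monoʳ-< (count isHalf S i) (ℕ.m<m+n (count isFull S i) (proj₂ found)) ⟩
        count isHalf S i + (count isFull S i + count isFull S i₀)
          ≤⟨ ℕ.+-monoʳ-≤ (count isHalf S i) (two-terms≤sum (count isFull S) i≢i₀) ⟩
        count isHalf S i + countTotal isFull S                     ≤⟨ spread i ⟩
        suc m                                                      ∎
        where open ℕ.≤-Reasoning
    α : Index d (suc m)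
    α = proj₁ ∘ choose
    V′ = countTotal value (delete S α)
    α-half : ∀ i → isHalf (S i (α i)) ≡ 0
    α-half i with choose i
    ... | _ , inj₁ (_ , eq) = cong isHalf eq
    ... | _ , inj₂ (_ , eq) = cong isHalf eq
    α-full : isFull (S i₀ (α i₀)) ≡ 1
    α-full with choose i₀
    ... | _ , inj₁ (_ , eq)    = cong isFull eq
    ... | _ , inj₂ (i₀≢i₀ , _) = ⊥-elim (i₀≢i₀ refl)
    α-none : ∀ i → i ≢ i₀ → isFull (S i (α i)) ≡ 0
    α-none i i≢i₀ with choose i
    ... | _ , inj₁ (i≡i₀ , _) = ⊥-elim (i≢i₀ i≡i₀)
    ... | _ , inj₂ (_ , eq)   = cong isFull eq
    full≡1 : countAt isFull S α ≡ 1
    full≡1 = trans (sum-single (λ i → isFull (S i (α i))) i₀ α-none) α-full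
    half≡0 : countAt isHalf S α ≡ 0
    half≡0 = sum-zero (λ i → isHalf (S i (α i))) α-half
    value≡2 : countAt value S α ≡ 2
    value≡2 = trans (countAt-value S α) (cong₂ (λ f h → f + f + h) full≡1 half≡0)

  -- Without fulls the spread condition is void, since no row of a table has more halves than columns.
  balanced-without-full : (S : Scores d n) → countTotal isFull S ≡ 0 → n + n ≤ countTotal isHalf S → Balanced S
  balanced-without-full S full≡0 enough = record
    { enough = subst (_ ≤_) (sym (trans (countTotal-value S)
                 (cong (λ f → f + f + countTotal isHalf S) full≡0))) enough
    ; spread = λ i → subst (_≤ _) (sym (trans (cong (count isHalf S i +_) full≡0) (ℕ.+-identityʳ _)))
                       (sum≤n (isHalf ∘ S i) (isHalf≤1 ∘ S i))
    }

  -- The dichotomy decides the columns in the remaining directions: two crowded rows supply enough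
  -- halves on their own, while a sparse row has a column without a score that can be used at no
  -- cost.
  record TwoHalves (S : Scores d n) : Set where
    field
      i₁ i₂ : Fin d
      j₁ j₂ : Fin n
      i₁≢i₂ : i₁ ≢ i₂
      half₁ : S i₁ j₁ ≡ half
      half₂ : S i₂ j₂ ≡ half
      crowded-or-sparse : (n ≤ count isHalf S i₁ × n ≤ count isHalf S i₂) ⊎
                          (∀ i → i ≢ i₁ → count isHalf S i < n)

  -- Row `i₁` has the most halves and `i₂` the most among the others. One row holds at most n of the
  -- 2n halves, so `i₂` has some; and if `i₂` has fewer than n, so has every row except possibly
  -- `i₁`.
  twoHalves : (S : Scores (suc d) (suc m)) → suc m + suc m ≤ countTotal isHalf S → TwoHalves S
  twoHalves {d} {m} S enough = record
    { i₁≢i₂ = λ i₁≡i₂ → i₂≢i₁ (sym i₁≡i₂) ; half₁ = 0<isHalf (proj₂ found₁) ; half₂ = 0<isHalf (proj₂ found₂)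
    ; crowded-or-sparse = crowded-or-sparse }
    where
    h : Fin (suc d) → ℕ
    h = count isHalf S
    i₁ = proj₁ (maximiser h)
    i₂ = proj₁ (maximiser (without h i₁))
    0<rest : 0 < sum (without h i₁)
    0<rest = ℕ.<-≤-trans (s≤s z≤n) (ℕ.+-cancelˡ-≤ (suc m) (suc m) _ (begin
      suc m + suc m                   ≤⟨ enough ⟩
      sum h                           ≡⟨ sum-without h i₁ ⟩
      h i₁ + sum (without h i₁)       ≤⟨ ℕ.+-monoˡ-≤ _ (sum≤n (isHalf ∘ S i₁) (isHalf≤1 ∘ S i₁)) ⟩
      suc m + sum (without h i₁)      ∎))
      where open ℕ.≤-Reasoning
    0<rest-i₂ : 0 < without h i₁ i₂
    0<rest-i₂ = let (i , 0<i) = positive-term (without h i₁) 0<rest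
                in ℕ.<-≤-trans 0<i (proj₂ (maximiser (without h i₁)) i)
    i₂≢i₁ : i₂ ≢ i₁
    i₂≢i₁ i₂≡i₁ = ℕ.<-irrefl refl (subst (0 <_) (trans (cong (without h i₁) i₂≡i₁) (without-self h i₁)) 0<rest-i₂)
    0<h₂ : 0 < h i₂
    0<h₂ = subst (0 <_) (without-other h i₂≢i₁) 0<rest-i₂
    h₂≤h₁ : h i₂ ≤ h i₁
    h₂≤h₁ = proj₂ (maximiser h) i₂
    found₁ = positive-term (isHalf ∘ S i₁) (ℕ.<-≤-trans 0<h₂ h₂≤h₁)
    found₂ = positive-term (isHalf ∘ S i₂) 0<h₂
    crowded-or-sparse : (suc m ≤ h i₁ × suc m ≤ h i₂) ⊎ (∀ i → i ≢ i₁ → h i < suc m)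
    crowded-or-sparse with suc m ℕ.≤? h i₂
    ... | yes n≤h₂ = inj₁ (ℕ.≤-trans n≤h₂ h₂≤h₁ , n≤h₂)
    ... | no  n≰h₂ = inj₂ λ i i≢i₁ → ℕ.≤-<-trans
      (subst₂ _≤_ (without-other h i≢i₁) (without-other h i₂≢i₁) (proj₂ (maximiser (without h i₁)) i)) (ℕ.≰⇒> n≰h₂)

  -- In the sparse case exactly two halves are spent. In the crowded case more may be lost
  -- elsewhere, but rows `i₁` and `i₂` still keep m halves each.
  step-half : (S : Scores (suc d) (suc m)) → Balanced S → countTotal isFull S ≡ 0 → HeavyStep S
  step-half {d} {m} S bal full≡0 = record
    { α = α ; heavy = heavy
    ; balanced = balanced-without-full (delete S α)
        (ℕ.m+n≡0⇒n≡0 (countAt isFull S α) (trans (sym (countTotal-delete isFull S α)) full≡0))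
        (remaining crowded-or-sparse)
    }
    where
    enough : suc m + suc m ≤ countTotal isHalf S
    enough = subst (suc m + suc m ≤_)
      (trans (countTotal-value S) (cong (λ f → f + f + countTotal isHalf S) full≡0)) (Balanced.enough bal)
    open TwoHalves (twoHalves S enough)
    column : ∀ i → i ≢ i₁ → ∃ λ j → suc m ≤ count isHalf S i₁ × suc m ≤ count isHalf S i₂ ⊎ S i j ≡ none
    column i i≢i₁ with crowded-or-sparse
    -- Any column serves here; the first one is taken.
    ... | inj₁ crowded = zero , inj₁ crowded
    ... | inj₂ sparse  = let (j , eq) = noneColumn S i few in j , inj₂ eq
      where
      few : count isFull S i + count isHalf S i < suc m
      few = subst (λ f → f + count isHalf S i < suc m)
        (sym (ℕ.n≤0⇒n≡0 (subst (count isFull S i ≤_) full≡0 (term≤sum (count isFull S) i)))) (sparse i i≢i₁)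
    α : Index (suc d) (suc m)
    α i with i ≟ i₁ | i ≟ i₂
    ... | yes _   | _     = j₁
    ... | no _    | yes _ = j₂
    ... | no i≢i₁ | no _  = proj₁ (column i i≢i₁)
    α₁ : S i₁ (α i₁) ≡ half
    α₁ with i₁ ≟ i₁
    ... | yes _    = half₁
    ... | no i₁≢i₁ = ⊥-elim (i₁≢i₁ refl)
    α₂ : S i₂ (α i₂) ≡ half
    α₂ with i₂ ≟ i₁ | i₂ ≟ i₂
    ... | yes i₂≡i₁ | _        = ⊥-elim (i₁≢i₂ (sym i₂≡i₁))
    ... | no _      | yes _    = half₂
    ... | no _      | no i₂≢i₂ = ⊥-elim (i₂≢i₂ refl)
    α-other : (∀ i → i ≢ i₁ → count isHalf S i < suc m) → ∀ i → i ≢ i₁ → i ≢ i₂ → isHalf (S i (α i)) ≡ 0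
    α-other sparse i i≢i₁ i≢i₂ with i ≟ i₁ | i ≟ i₂
    ... | yes i≡i₁ | _        = ⊥-elim (i≢i₁ i≡i₁)
    ... | no _     | yes i≡i₂ = ⊥-elim (i≢i₂ i≡i₂)
    ... | no i≢i₁′ | no _ with column i i≢i₁′
    ...   | _ , inj₁ (_ , crowded₂) = ⊥-elim (ℕ.<⇒≱ (sparse i₂ (λ i₂≡i₁ → i₁≢i₂ (sym i₂≡i₁))) crowded₂)
    ...   | _ , inj₂ eq             = cong isHalf eq
    heavy : Heavy S α
    heavy = subst₂ (λ a b → a + b ≤ countAt value S α) (cong value α₁) (cong value α₂)
      (two-terms≤sum (λ i → value (S i (α i))) i₁≢i₂)
    h′ : Fin (suc d) → ℕ
    h′ = count isHalf (delete S α)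
    still-m : ∀ i → S i (α i) ≡ half → suc m ≤ count isHalf S i → m ≤ h′ i
    still-m i eq n≤h = s≤s⁻¹ (subst (suc m ≤_)
      (trans (count-delete isHalf S α i) (cong (λ s → isHalf s + h′ i) eq)) n≤h)
    remaining : _ → m + m ≤ countTotal isHalf (delete S α)
    remaining (inj₁ (crowded₁ , crowded₂)) = ℕ.≤-trans
      (ℕ.+-mono-≤ (still-m i₁ α₁ crowded₁) (still-m i₂ α₂ crowded₂)) (two-terms≤sum h′ i₁≢i₂)
    remaining (inj₂ sparse) = ≤-by-balanceℕ enough (trans
      (cong (_+ (m + m)) (trans (countTotal-delete isHalf S α) (cong (_+ countTotal isHalf (delete S α)) half≡2)))
      (solve 2 (λ m t → (con 2 :+ t) :+ (m :+ m) := ((con 1 :+ m) :+ (con 1 :+ m)) :+ t) refl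
        m (countTotal isHalf (delete S α))))
      where
      half≡2 : countAt isHalf S α ≡ 2
      half≡2 = trans (sum-pair (λ i → isHalf (S i (α i))) i₁≢i₂ (α-other sparse))
                     (cong₂ _+_ (cong isHalf α₁) (cong isHalf α₂))

  heavyDiagonal : (S : Scores (suc d) n) → Balanced S → Diagonal (Heavy S)
  heavyDiagonal {d} {zero}  S bal = emptyDiagonal
  heavyDiagonal {d} {suc n} S bal = extendDiagonal α heavy (heavyDiagonal (delete S α) balanced)
    where
    step : HeavyStep S
    step with countTotal isFull S in eq
    ... | zero  = step-half S bal eq
    ... | suc _ = step-full S bal (subst (0 <_) (sym eq) (s≤s z≤n))
    open HeavyStep step

  -- The matrix D recognises the rows only up to pointwise equality, hence the demand that P respect
  -- it.
  diagonal⇒containsDiagonal : (B : Matrix01 d n) {P : Index d n → Set} → (∀ {α β} → α ≗ β → P α → P β) →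
                              (∀ α → P α → B α ≡ true) → Diagonal P → ContainsDiagonal B
  diagonal⇒containsDiagonal {d} {n} B P-resp P⇒B diag = D , isDiagonal , λ α Dα → let (r , α≗r) = D⇒row α Dα
                                                       in P⇒B α (P-resp (sym ∘ α≗r) (good r))
    where
    open Diagonal diag
    D? : (α : Index d n) → Dec (∃ λ r → α ≗ row r)
    D? α = any? (λ r → all? (λ i → α i ≟ row r i))
    D : Matrix01 d n
    D α = ⌊ D? α ⌋
    row⇒D : ∀ α r → α ≗ row r → D α ≡ true
    row⇒D α r α≗r with D? α
    ... | yes _  = refl
    ... | no ∄r  = ⊥-elim (∄r (r , α≗r))
    D⇒row : ∀ α → D α ≡ true → ∃ λ r → α ≗ row r
    D⇒row α Dα with D? α
    ... | yes r = r
    isDiagonal : IsDiagonal D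
    isDiagonal i j = let (r , ri≡j) = surjective i j in row r , ri≡j , row⇒D (row r) r (λ _ → refl) ,
      λ β βi≡j Dβ k → let (r′ , β≗r′) = D⇒row β Dβ
                      in trans (β≗r′ k) (cong (λ r → row r k)
                         (injective i (trans (sym (β≗r′ i)) (trans βi≡j (sym ri≡j)))))

  -- Diagonals from an optimal table of scores

  Covers : Matrix01 d n → (Fin d → Fin n → ℕ) → Set
  Covers A c = ∀ α → A (canon α) ≡ true → 2 ≤ sum (λ i → c i (α i))

  -- Doubled, so that everything is integral: W is twice the deficiency, and a Covers-table is twice a
  -- fractional cover.
  record ScoreCertificate (A : Matrix01 d n) (W : ℕ) : Set where
    field
      S      : Scores d n
      sound  : ∀ α → A α ≡ false → countAt value S α + W ≤ 2
      covers : Covers A (λ i j → value (S i j))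
      light  : countTotal value S + W ≤ n + n

  -- A cover has doubled weight at least 2n - W and the zero α removes at most 2 - W of it, so 2(n -
  -- 1) is left for the submatrix: W cancels. Since W is positive, α meets no full, and every heavy
  -- index is a one of A.
  score-diagonallyExtremal : (A : Matrix01 (suc d) (suc m)) (W : ℕ) → 1 ≤ W → ScoreCertificate A W →
    (∀ c → Covers A c → suc m + suc m ≤ sum (λ i → sum (c i)) + W) →
    ∀ α → A α ≡ false → ContainsDiagonal (sub A α)
  score-diagonallyExtremal {d} {m} A W 1≤W cert heavy-covers α off =
    diagonal⇒containsDiagonal (sub A α) {Heavy (delete S α)}
      (λ β≗γ → subst (2 ≤_) (sum-cong-≗ (λ i → cong (λ j → value (delete S α i j)) (β≗γ i))))
      heavy⇒true
      (heavyDiagonal (delete S α) (record { enough = enough ; spread = spread }))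
    where
    open ScoreCertificate cert
    open ℕ.≤-Reasoning
    H T H′ : ℕ
    H = countTotal isFull S
    T = countTotal isHalf S
    H′ = countTotal isFull (delete S α)
    heavy⇒true : ∀ β → Heavy (delete S α) β → sub A α β ≡ true
    heavy⇒true β heavy with sub A α β in eq
    ... | true  = refl
    ... | false = ⊥-elim (ℕ.<-irrefl refl (ℕ.≤-trans (ℕ.+-mono-≤ heavy 1≤W) (sound _ eq)))
    enough : m + m ≤ countTotal value (delete S α)
    enough = ≤-by-balanceℕ (ℕ.+-mono-≤ (heavy-covers (λ i j → value (S i j)) covers) (sound α off))
      (trans (cong (λ v → ((v + W) + 2) + (m + m)) (countTotal-delete value S α))
        (solve 4 (λ s v w m → ((((s :+ v) :+ w) :+ con 2) :+ (m :+ m)) :=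
                              ((((con 1 :+ m) :+ (con 1 :+ m)) :+ (s :+ w)) :+ v)) refl
          (countAt value S α) (countTotal value (delete S α)) W m))
    no-full : countAt isFull S α ≡ 0
    no-full with countAt isFull S α | countAt-value S α
    ... | zero  | _  = refl
    ... | suc f | eq = ⊥-elim (ℕ.<-irrefl refl (begin-strict
      2                                                <⟨ ℕ.+-monoʳ-≤ 2 1≤W ⟩
      2 + W
        ≤⟨ ℕ.+-monoˡ-≤ W (ℕ.+-mono-≤ {1} {suc f} {1} {suc f} (s≤s z≤n) (s≤s z≤n)) ⟩
      suc f + suc f + W                                ≤⟨ ℕ.+-monoˡ-≤ W (ℕ.m≤m+n (suc f + suc f) (countAt isHalf S α)) ⟩
      suc f + suc f + countAt isHalf S α + W           ≡⟨ cong (_+ W) eq ⟨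
      countAt value S α + W                            ≤⟨ sound α off ⟩
      2                                                ∎))
    H≡H′ : H ≡ H′
    H≡H′ = trans (countTotal-delete isFull S α) (cong (_+ H′) no-full)
    -- Once the halves of the other rows are raised to fulls, row i needs only its own fulls; by
    -- duality this cover cannot be lighter than the original one, so row i has few halves.
    module _ (i : Fin (suc d)) where
      t : ℕ
      t = count isHalf S i
      others : Fin (suc d) → Fin (suc m) → ℕ
      others k j = without (λ k → isHalf (S k j)) i k
      raised : Fin (suc d) → Fin (suc m) → ℕ
      raised k j = (isFull (S k j) + others k j) + (isFull (S k j) + others k j)
      raised-covers : Covers A raised
      raised-covers β on = subst (2 ≤_) (sym (∑-distrib-+ U U))
        (double (positive (F + O) refl))
        where
        F O : ℕ
        F = countAt isFull S β
        O = sum (λ k → others k (β k))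
        U : Fin (suc d) → ℕ
        U k = isFull (S k (β k)) + others k (β k)
        U≡F+O : sum U ≡ F + O
        U≡F+O = ∑-distrib-+ (λ k → isFull (S k (β k))) (λ k → others k (β k))
        double : 1 ≤ F + O → 2 ≤ sum U + sum U
        double 1≤ = subst₂ (λ x y → 2 ≤ x + y) (sym U≡F+O) (sym U≡F+O) (ℕ.+-mono-≤ 1≤ 1≤)
        -- A one of A missed by all fulls and by the halves of the other rows would keep only its
        -- score in row i, which is worth at most 1 instead of 2.
        positive : ∀ u → F + O ≡ u → 1 ≤ u
        positive (suc u) _    = s≤s z≤n
        positive zero F+O≡0 = ⊥-elim (ℕ.<-irrefl refl (begin-strict
          1                                        <⟨ covers β on ⟩
          countAt value S β                        ≡⟨ countAt-value S β ⟩
          F + F + countAt isHalf S β               ≡⟨ cong (λ f → f + f + countAt isHalf S β) (ℕ.m+n≡0⇒m≡0 F F+O≡0) ⟩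
          countAt isHalf S β                       ≡⟨ sum-without (λ k → isHalf (S k (β k))) i ⟩
          isHalf (S i (β i)) + O                   ≡⟨ cong (isHalf (S i (β i)) +_) (ℕ.m+n≡0⇒n≡0 F F+O≡0) ⟩
          isHalf (S i (β i)) + 0                   ≤⟨ ℕ.+-monoˡ-≤ 0 (isHalf≤1 (S i (β i))) ⟩
          1                                        ∎))
      X : ℕ
      X = sum (λ k → sum (others k))
      T≡t+X : T ≡ t + X
      T≡t+X = trans (sum-without (count isHalf S) i) (cong (t +_) (sum-cong-≗ row-others))
        where
        row-others : ∀ k → without (count isHalf S) i k ≡ sum (others k)
        row-others k with k ≟ i
        ... | yes _ = sym (sum-zero (λ (_ : Fin (suc m)) → 0) (λ _ → refl))
        ... | no _  = refl
      raised-total : sum (λ k → sum (raised k)) ≡ (H + X) + (H + X)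
      raised-total = trans (∑∑-distrib-+ (λ k j → isFull (S k j) + others k j) (λ k j → isFull (S k j) + others k j))
        (cong (λ x → x + x) (∑∑-distrib-+ (λ k j → isFull (S k j)) others))
      -- The raised table weighs 2H + 2X and the given one 2H + t + X, so minimality forces t ≤ X.
      t+t≤T : t + t ≤ T
      t+t≤T = ≤-by-balanceℕ (ℕ.≤-trans light (heavy-covers raised raised-covers)) (begin-equality
        (sum (λ k → sum (raised k)) + W) + (t + t)   ≡⟨ cong (λ r → (r + W) + (t + t)) raised-total ⟩
        (((H + X) + (H + X)) + W) + (t + t)
          ≡⟨ solve 4 (λ h x w t → ((((h :+ x) :+ (h :+ x)) :+ w) :+ (t :+ t)) :=
                                  ((((h :+ h) :+ (t :+ x)) :+ w) :+ (t :+ x))) refl H X W t ⟩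
        (((H + H) + (t + X)) + W) + (t + X)          ≡⟨ cong (λ T → (((H + H) + T) + W) + T) T≡t+X ⟨
        (((H + H) + T) + W) + T                      ≡⟨ cong (λ v → (v + W) + T) (countTotal-value S) ⟨
        (countTotal value S + W) + T                 ∎)
    spread : ∀ i → count isHalf (delete S α) i + H′ ≤ m
    spread i with suc m ℕ.≤? t i + H
    ... | no  n≰ = begin
      count isHalf (delete S α) i + H′    ≤⟨ ℕ.+-monoˡ-≤ H′ (subst (count isHalf (delete S α) i ≤_)
                                               (sym (count-delete isHalf S α i)) (ℕ.m≤n+m _ _)) ⟩
      t i + H′                            ≡⟨ cong (t i +_) H≡H′ ⟨
      t i + H                             ≤⟨ s≤s⁻¹ (ℕ.≰⇒> n≰) ⟩
      m                                   ∎
    -- Twice t i + H is at most the total value, which `light` and the positivity of W keep below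
    -- 2n.
    ... | yes n≤ = ⊥-elim (ℕ.<-irrefl refl (begin-strict
      suc m + suc m                       ≤⟨ ℕ.+-mono-≤ n≤ n≤ ⟩
      (t i + H) + (t i + H)
        ≡⟨ solve 2 (λ t h → (t :+ h) :+ (t :+ h) := (h :+ h) :+ (t :+ t)) refl (t i) H ⟩
      (H + H) + (t i + t i)               ≤⟨ ℕ.+-monoʳ-≤ (H + H) (t+t≤T i) ⟩
      (H + H) + T                         ≡⟨ countTotal-value S ⟨
      countTotal value S                  <⟨ ℕ.m<m+n (countTotal value S) 1≤W ⟩
      countTotal value S + W              ≤⟨ light ⟩
      suc m + suc m                       ∎))

-- Rational sums and linear forms

module _ where
  open import Data.Rational hiding (floor; _≟_)
  open import Data.Rational.Properties hiding (_≟_)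
  import Data.Rational.Properties as ℚ
  open import Data.Rational.Solver using (module +-*-Solver)
  open import Data.List.Extrema (DecTotalOrder.totalOrder ≤-decTotalOrder)
    using (max; min; min≤⊤; min≤xs; v≤min⁺; xs≤max; argmin; f[argmin]≤f[xs])
  open +-*-Solver using (solve; _:=_; _:+_; _:*_; _:-_; :-_; con)

  ≤-by-balance : ∀ {p q r s} → p ≤ q → q + r ≡ p + s → r ≤ s
  ≤-by-balance {p} {q} {r} {s} p≤q eq = begin
    r             ≡⟨ solve 2 (λ q r → r := (q :+ r) :+ (:- q)) refl q r ⟩
    (q + r) + - q ≡⟨ cong (_+ - q) eq ⟩
    (p + s) + - q ≤⟨ +-monoˡ-≤ (- q) (+-monoˡ-≤ s p≤q) ⟩
    (q + s) + - q ≡⟨ solve 2 (λ q s → (q :+ s) :+ (:- q) := s) refl q s ⟩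
    s             ∎
    where open ≤-Reasoning

  *-mono-≤-nonNeg : ∀ {c p q} → 0ℚ ≤ c → p ≤ q → c * p ≤ c * q
  *-mono-≤-nonNeg {c} 0≤c p≤q = *-monoˡ-≤-nonNeg c {{nonNegative 0≤c}} p≤q

  *-nonNeg : ∀ {p q} → 0ℚ ≤ p → 0ℚ ≤ q → 0ℚ ≤ p * q
  *-nonNeg {p} {q} 0≤p 0≤q = subst (_≤ p * q) (*-zeroʳ p) (*-mono-≤-nonNeg 0≤p 0≤q)

  +-nonNeg : ∀ {p q} → 0ℚ ≤ p → 0ℚ ≤ q → 0ℚ ≤ p + q
  +-nonNeg = +-mono-≤

  sumFin-cong : {f g : Fin k → ℚ} → (∀ i → f i ≡ g i) → sumFin k f ≡ sumFin k g
  sumFin-cong {zero}  eq = refl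
  sumFin-cong {suc k} eq = cong₂ _+_ (eq zero) (sumFin-cong (eq ∘ suc))

  sumFin-+ : (f g : Fin k → ℚ) → sumFin k (λ i → f i + g i) ≡ sumFin k f + sumFin k g
  sumFin-+ {zero}  f g = refl
  sumFin-+ {suc k} f g = trans (cong (f zero + g zero +_) (sumFin-+ (f ∘ suc) (g ∘ suc)))
    (solve 4 (λ a b c d → (a :+ b) :+ (c :+ d) := (a :+ c) :+ (b :+ d)) refl
      (f zero) (g zero) (sumFin k (f ∘ suc)) (sumFin k (g ∘ suc)))

  sumFin-*ˡ : (c : ℚ) (f : Fin k → ℚ) → sumFin k (λ i → c * f i) ≡ c * sumFin k f
  sumFin-*ˡ {zero}  c f = sym (*-zeroʳ c)
  sumFin-*ˡ {suc k} c f = trans (cong (c * f zero +_) (sumFin-*ˡ c (f ∘ suc)))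
    (sym (*-distribˡ-+ c (f zero) (sumFin k (f ∘ suc))))

  dot : (Fin k → ℚ) → (Fin k → ℚ) → ℚ
  dot {k} a y = sumFin k (λ i → a i * y i)

  dot-+ : (a a′ y : Fin k → ℚ) → dot (λ i → a i + a′ i) y ≡ dot a y + dot a′ y
  dot-+ a a′ y = trans (sumFin-cong (λ i → *-distribʳ-+ (y i) (a i) (a′ i))) 
    (sumFin-+ (λ i → a i * y i) (λ i → a′ i * y i))

  dot-*ˡ : (c : ℚ) (a y : Fin k → ℚ) → dot (λ i → c * a i) y ≡ c * dot a y
  dot-*ˡ c a y = trans (sumFin-cong (λ i → *-assoc c (a i) (y i))) 
    (sumFin-*ˡ c (λ i → a i * y i))

  -- Farkas' lemma by Fourier-Motzkin elimination

  Row : ℕ → Set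
  Row k = (Fin k → ℚ) × ℚ

  Sat : (Fin k → ℚ) → Row k → Set
  Sat y (a , b) = dot a y ≤ b

  infixl 6 _+ᵣ_
  _+ᵣ_ : Row k → Row k → Row k
  (a , b) +ᵣ (a′ , b′) = (λ i → a i + a′ i) , b + b′

  infixl 7 _*ᵣ_
  _*ᵣ_ : ℚ → Row k → Row k
  c *ᵣ (a , b) = (λ i → c * a i) , c * b

  -- P r is meant to say that the inequality r is a nonnegative combination of given ones; keeping P
  -- abstract spares the elimination from carrying the multipliers around.
  record IsCone (P : Row k → Set) : Set where
    field
      add   : ∀ {r s} → P r → P s → P (r +ᵣ s)
      scale : ∀ {c r} → 0ℚ ≤ c → P r → P (c *ᵣ r)

  Infeasible : (Row k → Set) → Set
  Infeasible P = ∃ λ r → P r × (∀ i → proj₁ r i ≡ 0ℚ) × proj₂ r < 0ℚ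

  tailᵣ : Row (suc k) → Row k
  tailᵣ (a , b) = a ∘ suc , b

  headᵣ : Row (suc k) → ℚ
  headᵣ (a , b) = a zero

  -- The tail is compared pointwise, since coefficient functions that agree everywhere need not be
  -- equal.
  Eliminated : (Row (suc k) → Set) → Row k → Set
  Eliminated P (a , b) = ∃ λ v → P (v , b) × v zero ≡ 0ℚ × (∀ i → v (suc i) ≡ a i)

  eliminated-isCone : {P : Row (suc k) → Set} → IsCone P → IsCone (Eliminated P)
  eliminated-isCone cone = record
    { add   = λ { (v , Pv , v0 , vs) (w , Pw , w0 , ws) →
                  (λ i → v i + w i) , add Pv Pw , cong₂ _+_ v0 w0 , λ i → cong₂ _+_ (vs i) (ws i) }
    ; scale = λ { {c} 0≤c (v , Pv , v0 , vs) →
                  (λ i → c * v i) , scale 0≤c Pv , trans (cong (c *_) v0) (*-zeroʳ c) ,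
                  λ i → cong (c *_) (vs i) }
    }
    where open IsCone cone

  HeadedRow : (Row (suc k) → Set) → ℚ → Set
  HeadedRow P h = ∃ λ r → P r × headᵣ r ≡ h

  SatAll : {P : Row (suc k) → Set} {h : ℚ} → (Fin (suc k) → ℚ) → List (HeadedRow P h) → Set
  SatAll y = All (Sat y ∘ proj₁)

  scale-head : {P : Row (suc k) → Set} → IsCone P → ∀ {r} → P r → ∀ c {h} → 0ℚ < c →
               c * headᵣ r ≡ h → ∃ λ (s : HeadedRow P h) → ∀ y → Sat y (proj₁ s) → Sat y r
  scale-head cone {r@(a , b)} Pr c 0<c eq = (c *ᵣ r , IsCone.scale cone (<⇒≤ 0<c) Pr , eq) ,
    λ y sat → *-cancelˡ-≤-pos c {{positive 0<c}} (subst (_≤ c * b) (dot-*ˡ c a y) sat)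

  -- Division by the absolute value of the leading coefficient turns a row into a plain upper or
  -- lower bound on the first variable.
  normalise : {P : Row (suc k) → Set} → IsCone P → ∀ {r} → P r →
    (headᵣ r ≡ 0ℚ) ⊎ (∃ λ (s : HeadedRow P 1ℚ) → ∀ y → Sat y (proj₁ s) → Sat y r)
                   ⊎ (∃ λ (s : HeadedRow P (- 1ℚ)) → ∀ y → Sat y (proj₁ s) → Sat y r)
  normalise cone {r} Pr with <-cmp (headᵣ r) 0ℚ
  ... | tri≈ _ h≡0 _ = inj₁ h≡0
  ... | tri> _ _ 0<h = inj₂ (inj₁ (scale-head cone Pr (1/ h) (positive⁻¹ (1/ h) {{1/pos⇒pos h}}) (*-inverseˡ h)))
    where h = headᵣ r
          instance _ = positive 0<h
                   _ = pos⇒nonZero h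
  ... | tri< h<0 _ _ = inj₂ (inj₂ (scale-head cone Pr (- (1/ h)) (neg-antimono-< (negative⁻¹ (1/ h) {{1/neg⇒neg h}}))
                             (trans (sym (neg-distribˡ-* (1/ h) h)) (cong -_ (*-inverseˡ h)))))
    where h = headᵣ r
          instance _ = negative h<0
                   _ = neg⇒nonZero h

  split : {P : Row (suc k) → Set} → IsCone P → ∀ {rs} → All P rs →
    ∃ λ (zs : List (HeadedRow P 0ℚ)) → ∃₂ λ (us : List (HeadedRow P 1ℚ)) (ls : List (HeadedRow P (- 1ℚ))) →
    ∀ y → SatAll y zs → SatAll y us → SatAll y ls → All (Sat y) rs
  split cone [] = [] , [] , [] , λ _ _ _ _ → []
  split cone (Pr ∷ Prs) with split cone Prs | normalise cone Pr
  ... | zs , us , ls , snd | inj₁ h≡0 =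
    (_ , Pr , h≡0) ∷ zs , us , ls , λ { y (z ∷ zs) us ls → z ∷ snd y zs us ls }
  ... | zs , us , ls , snd | inj₂ (inj₁ (u , u⇒r)) =
    zs , u ∷ us , ls , λ { y zs (u ∷ us) ls → u⇒r y u ∷ snd y zs us ls }
  ... | zs , us , ls , snd | inj₂ (inj₂ (l , l⇒r)) =
    zs , us , l ∷ ls , λ { y zs us (l ∷ ls) → l⇒r y l ∷ snd y zs us ls }

  separate : (ls us : List ℚ) → All (λ l → All (l ≤_) us) ls →
             ∃ λ x → All (_≤ x) ls × All (x ≤_) us
  -- Without upper bounds every value above the lower bounds will do; 0 is only the seed of the
  -- maximum.
  separate ls []       _     = max 0ℚ ls , xs≤max 0ℚ ls , []
  separate ls (u ∷ us) ls≤us =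
    min u us , All.map (λ { (l≤u ∷ l≤us) → v≤min⁺ l≤u l≤us }) ls≤us , min≤⊤ u us ∷ min≤xs u us

  eliminate : {P : Row (suc k) → Set} → IsCone P → HeadedRow P (- 1ℚ) → HeadedRow P 1ℚ →
              ∃ (Eliminated P)
  eliminate cone (l , Pl , l₀) (u , Pu , u₀) =
    tailᵣ (l +ᵣ u) , _ , IsCone.add cone Pl Pu , trans (cong₂ _+_ l₀ u₀) refl , λ _ → refl

  kept : {P : Row (suc k) → Set} → HeadedRow P 0ℚ → ∃ (Eliminated P)
  kept (z , Pz , z₀) = tailᵣ z , _ , Pz , z₀ , λ _ → refl

  module _ {P : Row (suc k) → Set} (y : Fin k → ℚ) where

    slack : Row (suc k) → ℚ
    slack (a , b) = b - dot (a ∘ suc) y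

    lowerBound : HeadedRow P (- 1ℚ) → ℚ
    lowerBound (r , _) = - slack r

    upperBound : HeadedRow P 1ℚ → ℚ
    upperBound (r , _) = slack r

    kept-sat : ∀ x (z : HeadedRow P 0ℚ) → Sat y (proj₁ (kept z)) → Sat (x ∷ᶠ y) (proj₁ z)
    kept-sat x ((a , b) , _ , a₀) sat =
      subst (_≤ b) (sym (trans (cong (λ h → h * x + dot (a ∘ suc) y) a₀)
        (solve 2 (λ x s → con 0ℚ :* x :+ s := s) refl x (dot (a ∘ suc) y)))) sat

    upper-sat : ∀ x (u : HeadedRow P 1ℚ) → x ≤ upperBound u → Sat (x ∷ᶠ y) (proj₁ u)
    upper-sat x ((a , b) , _ , a₀) x≤ = ≤-by-balance x≤
      (trans (cong (λ h → (b - s) + (h * x + s)) a₀)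
             (solve 3 (λ x s b → (b :- s) :+ (con 1ℚ :* x :+ s) := x :+ b) refl x s b))
      where s = dot (a ∘ suc) y

    lower-sat : ∀ x (l : HeadedRow P (- 1ℚ)) → lowerBound l ≤ x → Sat (x ∷ᶠ y) (proj₁ l)
    lower-sat x ((a , b) , _ , a₀) ≤x = ≤-by-balance ≤x
      (trans (cong (λ h → x + (h * x + s)) a₀)
             (solve 3 (λ x s b → x :+ (con (- 1ℚ) :* x :+ s) := (:- (b :- s)) :+ b) refl x s b))
      where s = dot (a ∘ suc) y

    bounds-ordered : (cone : IsCone P) (l : HeadedRow P (- 1ℚ)) (u : HeadedRow P 1ℚ) →
                     Sat y (proj₁ (eliminate cone l u)) → lowerBound l ≤ upperBound u
    bounds-ordered cone ((a , b) , _) ((a′ , b′) , _) sat = ≤-by-balance sat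
      (trans (solve 4 (λ s s′ b b′ → (b :+ b′) :+ (:- (b :- s)) := (s :+ s′) :+ (b′ :- s′)) refl
               (dot (a ∘ suc) y) (dot (a′ ∘ suc) y) b b′)
             (cong (_+ (b′ - dot (a′ ∘ suc) y)) (sym (dot-+ (a ∘ suc) (a′ ∘ suc) y))))

  -- The sums of a lower and an upper row say that each lower bound on the first variable is below
  -- each upper one, so a solution for the other variables extends by a value in between. A
  -- contradiction among the eliminated rows is already one among rows of P, because their leading
  -- coefficient is 0.
  farkas : {P : Row k → Set} → IsCone P → ∀ {rs} → All P rs →
           (∃ λ y → All (Sat y) rs) ⊎ Infeasible P
  farkas {zero}  cone [] = inj₁ ((λ ()) , [])
  farkas {zero}  cone {(a , b) ∷ _} (Pr ∷ Prs) with b <? 0ℚ | farkas cone Prs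
  ... | yes b<0 | _                = inj₂ (_ , Pr , (λ ()) , b<0)
  ... | no  b≮0 | inj₂ infeasible  = inj₂ infeasible
  ... | no  b≮0 | inj₁ (y , sats)  = inj₁ (y , ≮⇒≥ b≮0 ∷ sats)
  farkas {suc k} {P} cone Prs with split cone Prs
  ... | zs , us , ls , sound
    with farkas (eliminated-isCone cone)
           (All.++⁺ (All.map⁺ {f = proj₁} (All.universal proj₂ (map kept zs)))
                    (All.map⁺ {f = proj₁} (All.universal proj₂ (cartesianProductWith (eliminate cone) ls us))))
  ... | inj₂ ((a , b) , (v , Pv , v₀ , vs) , a≡0 , b<0) =
    inj₂ ((v , b) , Pv , (λ { zero → v₀ ; (suc i) → trans (vs i) (a≡0 i) }) , b<0)
  ... | inj₁ (y , sats) = inj₁ (x ∷ᶠ y , sound (x ∷ᶠ y)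
          (All.map (λ {z} → kept-sat y x z) (All.map⁻ (All.map⁻ (All.++⁻ˡ _ sats))))
          (All.map (λ {u} → upper-sat y x u) (All.map⁻ (proj₂ (proj₂ separation))))
          (All.map (λ {l} → lower-sat y x l) (All.map⁻ (proj₁ (proj₂ separation)))))
    where
    sats′ = All.map⁻ (All.++⁻ʳ (map proj₁ (map kept zs)) sats)
    separation = separate (map (lowerBound y) ls) (map (upperBound y) us)
      (All.map⁺ (All.tabulate λ {l} l∈ → All.map⁺ (All.tabulate λ {u} u∈ →
        bounds-ordered y cone l u (All.lookup sats′ (∈-cartesianProductWith⁺ (eliminate cone) l∈ u∈)))))
    x = proj₁ separation

  -- Sums over indices

  sumFin-mono : {f g : Fin k → ℚ} → (∀ i → f i ≤ g i) → sumFin k f ≤ sumFin k g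
  sumFin-mono {zero}  f≤g = ≤-refl
  sumFin-mono {suc k} f≤g = +-mono-≤ (f≤g zero) (sumFin-mono (f≤g ∘ suc))

  sumFin-zero : ∀ k → sumFin k (λ _ → 0ℚ) ≡ 0ℚ
  sumFin-zero zero    = refl
  sumFin-zero (suc k) = trans (+-identityˡ _) (sumFin-zero k)

  sumFin-single : ∀ i (f : Fin k → ℚ) → (∀ j → j ≢ i → f j ≡ 0ℚ) → sumFin k f ≡ f i
  sumFin-single {suc k} zero f off = trans
    (cong (f zero +_) (trans (sumFin-cong (λ j → off (suc j) λ ())) (sumFin-zero k)))
    (+-identityʳ (f zero))
  sumFin-single (suc i) f off = trans
    (cong₂ _+_ (off zero λ ()) (sumFin-single i (f ∘ suc) (λ j j≢i → off (suc j) (j≢i ∘ suc-injective))))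
    (+-identityˡ (f (suc i)))

  sumFin-++ : ∀ m n (f : Fin (m ℕ.+ n) → ℚ) →
              sumFin (m ℕ.+ n) f ≡ sumFin m (λ i → f (i ↑ˡ n)) + sumFin n (λ j → f (m ↑ʳ j))
  sumFin-++ zero    n f = sym (+-identityˡ (sumFin n f))
  sumFin-++ (suc m) n f = trans (cong (f zero +_) (sumFin-++ m n (f ∘ suc)))
    (sym (+-assoc (f zero) (sumFin m (λ i → f (suc (i ↑ˡ n)))) (sumFin n (λ j → f (suc (m ↑ʳ j))))))

  sumFin-combine : ∀ m n (f : Fin (m ℕ.* n) → ℚ) →
                   sumFin (m ℕ.* n) f ≡ sumFin m (λ i → sumFin n (λ j → f (combine i j)))
  sumFin-combine zero    n f = refl
  sumFin-combine (suc m) n f = trans (sumFin-++ n (m ℕ.* n) f)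
    (cong (sumFin n (λ j → f (j ↑ˡ (m ℕ.* n))) +_) (sumFin-combine m n (λ k → f (n ↑ʳ k))))

  sumIdx-mono : {f g : Index d n → ℚ} → (∀ α → f (canon α) ≤ g (canon α)) → sumIdx d n f ≤ sumIdx d n g
  sumIdx-mono {zero}  f≤g = f≤g (λ ())
  sumIdx-mono {suc d} f≤g = sumFin-mono (λ j → sumIdx-mono (λ α → f≤g (j ∷ᶠ α)))

  sumIdx-cong : {f g : Index d n → ℚ} → (∀ α → f (canon α) ≡ g (canon α)) → sumIdx d n f ≡ sumIdx d n g
  sumIdx-cong eq = ≤-antisym (sumIdx-mono (≤-reflexive ∘ eq)) (sumIdx-mono (≤-reflexive ∘ sym ∘ eq))

  sumIdx-+ : (f g : Index d n → ℚ) → sumIdx d n (λ α → f α + g α) ≡ sumIdx d n f + sumIdx d n g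
  sumIdx-+ {zero}  f g = refl
  sumIdx-+ {suc d} f g = trans (sumFin-cong (λ j → sumIdx-+ (f ∘ (j ∷ᶠ_)) (g ∘ (j ∷ᶠ_))))
    (sumFin-+ (λ j → sumIdx d _ (f ∘ (j ∷ᶠ_))) (λ j → sumIdx d _ (g ∘ (j ∷ᶠ_))))

  sumIdx-*ˡ : (c : ℚ) (f : Index d n → ℚ) → sumIdx d n (λ α → c * f α) ≡ c * sumIdx d n f
  sumIdx-*ˡ {zero}  c f = refl
  sumIdx-*ˡ {suc d} c f = trans (sumFin-cong (λ j → sumIdx-*ˡ c (f ∘ (j ∷ᶠ_))))
    (sumFin-*ˡ c (λ j → sumIdx d _ (f ∘ (j ∷ᶠ_))))

  sumIdx-zero : ∀ d n → sumIdx d n (λ _ → 0ℚ) ≡ 0ℚ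
  sumIdx-zero zero    n = refl
  sumIdx-zero (suc d) n = trans (sumFin-cong {k = n} (λ _ → sumIdx-zero d n)) (sumFin-zero n)

  sumIdx-sumFin : (f : Fin k → Index d n → ℚ) →
                  sumIdx d n (λ α → sumFin k (λ i → f i α)) ≡ sumFin k (λ i → sumIdx d n (f i))
  sumIdx-sumFin {zero}  {d} {n} f = sumIdx-zero d n
  sumIdx-sumFin {suc k} f = trans (sumIdx-+ (f zero) (λ α → sumFin k (λ i → f (suc i) α)))
    (cong (sumIdx _ _ (f zero) +_) (sumIdx-sumFin (f ∘ suc)))

  sumIdx-single : ∀ α (f : Index d n → ℚ) → (∀ β → ¬ β ≗ α → f β ≡ 0ℚ) → sumIdx d n f ≡ f (canon α)
  sumIdx-single {zero}  α f off = refl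
  sumIdx-single {suc d} α f off = trans
    (sumFin-single (α zero) (λ j → sumIdx d _ (f ∘ (j ∷ᶠ_))) λ j j≢α₀ →
      trans (sumIdx-cong (λ β → off (j ∷ᶠ canon β) (λ eq → j≢α₀ (eq zero)))) (sumIdx-zero d _))
    (sumIdx-single (α ∘ suc) (f ∘ (α zero ∷ᶠ_)) λ β β≇α → off _ λ eq → β≇α (eq ∘ suc))

  -- Hyperplane weights and weak duality

  weight : (Fin d → Fin n → ℚ) → Index d n → ℚ
  weight {d} lam α = sumFin d (λ i → lam i (α i))

  weight-cong : (lam : Fin d → Fin n → ℚ) {α β : Index d n} → α ≗ β → weight lam α ≡ weight lam β
  weight-cong lam α≗β = sumFin-cong (λ i → cong (lam i) (α≗β i))

  totalWeight : (Fin d → Fin n → ℚ) → ℚ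
  totalWeight {d} {n} lam = sumFin d (λ i → sumFin n (lam i))

  if-≟-yes : (i : Fin n) {x y : ℚ} → (if ⌊ i ≟ i ⌋ then x else y) ≡ x
  if-≟-yes i with i ≟ i
  ... | yes _  = refl
  ... | no i≢i = ⊥-elim (i≢i refl)

  if-≟-no : {i j : Fin n} {x y : ℚ} → i ≢ j → (if ⌊ i ≟ j ⌋ then x else y) ≡ y
  if-≟-no {i = i} {j} i≢j with i ≟ j
  ... | yes i≡j = ⊥-elim (i≢j i≡j)
  ... | no _    = refl

  -- Double counting: an index lies in exactly one hyperplane of direction i.
  sumFin-hypSum : (c : Fin n → ℚ) (K : QMatrix d n) (i : Fin d) →
    sumFin n (λ j → c j * hypSum K i j) ≡ sumIdx d n (λ α → c (α i) * K α)
  sumFin-hypSum {n} {d} c K i = begin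
    sumFin n (λ j → c j * hypSum K i j)
      ≡⟨ sumFin-cong (λ j → sym (sumIdx-*ˡ (c j) (slice j))) ⟩
    sumFin n (λ j → sumIdx d n (λ α → c j * slice j α))
      ≡⟨ sumIdx-sumFin (λ j α → c j * slice j α) ⟨
    sumIdx d n (λ α → sumFin n (λ j → c j * slice j α))
      ≡⟨ sumIdx-cong (λ α → let α = canon α in trans
           (sumFin-single (α i) (λ j → c j * slice j α)
             (λ j j≢αi → trans (cong (c j *_) (if-≟-no (j≢αi ∘ sym))) (*-zeroʳ (c j))))
           (cong (c (α i) *_) (if-≟-yes (α i)))) ⟩
    sumIdx d n (λ α → c (α i) * K α) ∎
    where
    open ≡-Reasoning
    slice : Fin n → Index d n → ℚ
    slice j α = if ⌊ α i ≟ j ⌋ then K α else 0ℚ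

  -- Weak duality before any covering condition is imposed. In this form it also applies in
  -- `zero-weight`, where K need not be contained in A.
  sumIdx-weight-≤ : (lam : Fin d → Fin n → ℚ) → (∀ i j → 0ℚ ≤ lam i j) →
    (K : QMatrix d n) → (∀ i j → hypSum K i j ≤ 1ℚ) →
    sumIdx d n (λ α → weight lam α * K α) ≤ totalWeight lam
  sumIdx-weight-≤ {d} {n} lam lam≥0 K hyp≤1 = begin
    sumIdx d n (λ α → weight lam α * K α)
      ≡⟨ sumIdx-cong (λ α → distrib (canon α)) ⟩
    sumIdx d n (λ α → sumFin d (λ i → lam i (α i) * K α))
      ≡⟨ sumIdx-sumFin (λ i α → lam i (α i) * K α) ⟩
    sumFin d (λ i → sumIdx d n (λ α → lam i (α i) * K α))
      ≡⟨ sumFin-cong (λ i → sumFin-hypSum (lam i) K i) ⟨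
    sumFin d (λ i → sumFin n (λ j → lam i j * hypSum K i j))
      ≤⟨ sumFin-mono (λ i → sumFin-mono (λ j → subst (lam i j * hypSum K i j ≤_) (*-identityʳ (lam i j))
           (*-mono-≤-nonNeg (lam≥0 i j) (hyp≤1 i j)))) ⟩
    totalWeight lam ∎
    where
    open ≤-Reasoning
    distrib : ∀ α → weight lam α * K α ≡ sumFin d (λ i → lam i (α i) * K α)
    distrib α = trans (*-comm (weight lam α) (K α)) (trans (sym (sumFin-*ˡ (K α) (λ i → lam i (α i))))
      (sumFin-cong (λ i → *-comm (K α) (lam i (α i)))))

  -- Supported matrices and linearity of hyperplane sums

  -- `Contains` speaks of all copies of an index, `SupportedOn` only of canonical ones. Restriction
  -- bridges the two and leaves the sums of a supported matrix unchanged.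
  restrict : Matrix01 d n → QMatrix d n → QMatrix d n
  restrict A K α = if A α then K α else 0ℚ

  restrict-nonNeg : (A : Matrix01 d n) {K : QMatrix d n} → (∀ α → 0ℚ ≤ K α) → ∀ α → 0ℚ ≤ restrict A K α
  restrict-nonNeg A K≥0 α with A α
  ... | true  = K≥0 α
  ... | false = ≤-refl

  restrict-contained : (A : Matrix01 d n) (K : QMatrix d n) → Contains A (restrict A K)
  restrict-contained A K α ≢0 with A α
  ... | true  = refl
  ... | false = ⊥-elim (≢0 refl)

  SupportedOn : Matrix01 d n → QMatrix d n → Set
  SupportedOn A K = ∀ α → A (canon α) ≡ false → K (canon α) ≡ 0ℚ

  restrict-canon : (A : Matrix01 d n) (K : QMatrix d n) → SupportedOn A K →
                   ∀ α → restrict A K (canon α) ≡ K (canon α)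
  restrict-canon A K supp α with A (canon α) in eq
  ... | true  = refl
  ... | false = sym (supp α eq)

  indicator : Index d n → QMatrix d n
  indicator α β = if ⌊ all? (λ i → β i ≟ α i) ⌋ then 1ℚ else 0ℚ

  indicator-off : (α β : Index d n) → ¬ β ≗ α → indicator α β ≡ 0ℚ
  indicator-off α β β≇α with all? (λ i → β i ≟ α i)
  ... | yes β≗α = ⊥-elim (β≇α β≗α)
  ... | no _    = refl

  indicator-on : (α β : Index d n) → β ≗ α → indicator α β ≡ 1ℚ
  indicator-on α β β≗α with all? (λ i → β i ≟ α i)
  ... | yes _  = refl
  ... | no β≇α = ⊥-elim (β≇α β≗α)

  indicator-nonNeg : (α β : Index d n) → 0ℚ ≤ indicator α β
  indicator-nonNeg α β with all? (λ i → β i ≟ α i)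
  ... | yes _ = nonNegative⁻¹ 1ℚ
  ... | no _  = ≤-refl

  total-indicator : (α : Index d n) → total (indicator α) ≡ 1ℚ
  total-indicator α = trans (sumIdx-single α (indicator α) (indicator-off α)) (indicator-on α (canon α) (canon-≗ α))

  [_≟_]ℚ : Fin n → Fin n → ℚ
  [ i ≟ j ]ℚ = if ⌊ i ≟ j ⌋ then 1ℚ else 0ℚ

  hypSum-indicator : (α : Index d n) (i : Fin d) (j : Fin n) → hypSum (indicator α) i j ≡ [ α i ≟ j ]ℚ
  hypSum-indicator α i j = trans (sumIdx-single α slice off)
    (cong₂ (λ l x → if ⌊ l ≟ j ⌋ then x else 0ℚ) (canon-≗ α i) (indicator-on α (canon α) (canon-≗ α)))
    where
    slice : Index _ _ → ℚ
    slice β = if ⌊ β i ≟ j ⌋ then indicator α β else 0ℚ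
    off : ∀ β → ¬ β ≗ α → slice β ≡ 0ℚ
    off β β≇α with β i ≟ j
    ... | yes _ = indicator-off α β β≇α
    ... | no _  = refl

  allIndices : ∀ d n → List (Index d n)
  allIndices zero    n = (λ ()) ∷ []
  allIndices (suc d) n = cartesianProductWith _∷ᶠ_ (allFin n) (allIndices d n)

  canon∈allIndices : (α : Index d n) → canon α ∈ allIndices d n
  canon∈allIndices {zero}  α = here refl
  canon∈allIndices {suc d} α = ∈-cartesianProductWith⁺ _∷ᶠ_ (∈-allFin (α zero)) (canon∈allIndices (α ∘ suc))

  total-hypSum : (K : QMatrix (suc d) n) → total K ≡ sumFin n (hypSum K zero)
  total-hypSum {d} {n} K = begin
    total K
      ≡⟨ sumIdx-cong {f = K} {g = λ α → 1ℚ * K α} (λ α → sym (*-identityˡ (K (canon α)))) ⟩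
    sumIdx (suc d) n (λ α → 1ℚ * K α)        ≡⟨ sumFin-hypSum (λ _ → 1ℚ) K zero ⟨
    sumFin n (λ j → 1ℚ * hypSum K zero j)    ≡⟨ sumFin-cong (λ j → *-identityˡ (hypSum K zero j)) ⟩
    sumFin n (hypSum K zero)                 ∎
    where open ≡-Reasoning

  hypSum-+ : (K L : QMatrix d n) → ∀ i j → hypSum (λ α → K α + L α) i j ≡ hypSum K i j + hypSum L i j
  hypSum-+ K L i j = trans (sumIdx-cong (λ α → if-+ (⌊ canon α i ≟ j ⌋)))
    (sumIdx-+ (λ α → if ⌊ α i ≟ j ⌋ then K α else 0ℚ) (λ α → if ⌊ α i ≟ j ⌋ then L α else 0ℚ))
    where
    if-+ : ∀ b {x y} → (if b then x + y else 0ℚ) ≡ (if b then x else 0ℚ) + (if b then y else 0ℚ)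
    if-+ true  = refl
    if-+ false = refl

  hypSum-*ˡ : (c : ℚ) (K : QMatrix d n) → ∀ i j → hypSum (λ α → c * K α) i j ≡ c * hypSum K i j
  hypSum-*ˡ c K i j = trans (sumIdx-cong (λ α → if-* (⌊ canon α i ≟ j ⌋)))
    (sumIdx-*ˡ c (λ α → if ⌊ α i ≟ j ⌋ then K α else 0ℚ))
    where
    if-* : ∀ b {x} → (if b then c * x else 0ℚ) ≡ c * (if b then x else 0ℚ)
    if-* true  = refl
    if-* false = sym (*-zeroʳ c)

  hypSum-cong : {K L : QMatrix d n} → (∀ α → K (canon α) ≡ L (canon α)) → ∀ i j → hypSum K i j ≡ hypSum L i j
  hypSum-cong K≡L i j = sumIdx-cong (λ α → cong (if ⌊ canon α i ≟ j ⌋ then_else 0ℚ) (K≡L α))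

  hypSum-zero : ∀ d n i j → hypSum {d} {n} (λ _ → 0ℚ) i j ≡ 0ℚ
  hypSum-zero d n i j = trans (sumIdx-cong (λ α → if-same ⌊ canon α i ≟ j ⌋)) (sumIdx-zero d n)
    where
    if-same : ∀ b → (if b then 0ℚ else 0ℚ) ≡ 0ℚ
    if-same true  = refl
    if-same false = refl

  -- Strong duality through the covering system

  -- The rows that follow from the covering system below: a supported matrix K gives the multipliers of
  -- the covering constraints, s that of the weight bound, and the slack in hypSum-bound and
  -- total-bound those of the sign constraints.
  record Certificate (A : Matrix01 d n) (w : ℚ) (r : Row (d ℕ.* n)) : Set where
    field
      K           : QMatrix d n
      s           : ℚ
      K≥0         : ∀ α → 0ℚ ≤ K α
      s≥0         : 0ℚ ≤ s
      supported   : SupportedOn A K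
      hypSum-bound : ∀ i j → hypSum K i j + proj₁ r (combine i j) ≤ s
      total-bound : s * w ≤ proj₂ r + total K

  certificate-isCone : (A : Matrix01 d n) (w : ℚ) → IsCone (Certificate A w)
  certificate-isCone {d} {n} A w = record { add = add ; scale = λ {c} {r} → scale {c} {r} }
    where
    add : ∀ {r r′} → Certificate A w r → Certificate A w r′ → Certificate A w (r +ᵣ r′)
    add {a , b} {a′ , b′} C C′ = record
      { K = λ α → C.K α + C′.K α ; s = C.s + C′.s
      ; K≥0 = λ α → +-nonNeg (C.K≥0 α) (C′.K≥0 α) ; s≥0 = +-nonNeg C.s≥0 C′.s≥0
      ; supported = λ α off → cong₂ _+_ (C.supported α off) (C′.supported α off)
      ; hypSum-bound = λ i j → ≤-by-balance (+-mono-≤ (C.hypSum-bound i j) (C′.hypSum-bound i j))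
          (trans (cong (λ h → (C.s + C′.s) + (h + (a (combine i j) + a′ (combine i j))))
                       (hypSum-+ C.K C′.K i j))
            (solve 6 (λ s s′ h h′ a a′ → (s :+ s′) :+ ((h :+ h′) :+ (a :+ a′)) :=
                                         ((h :+ a) :+ (h′ :+ a′)) :+ (s :+ s′))
              refl C.s C′.s (hypSum C.K i j) (hypSum C′.K i j) (a (combine i j)) (a′ (combine i j))))
      ; total-bound = ≤-by-balance (+-mono-≤ C.total-bound C′.total-bound)
          (trans (solve 7 (λ s s′ w b b′ t t′ → ((b :+ t) :+ (b′ :+ t′)) :+ (s :+ s′) :* w :=
                             (s :* w :+ s′ :* w) :+ ((b :+ b′) :+ (t :+ t′)))
                   refl C.s C′.s w b b′ (total C.K) (total C′.K))
            (cong (λ t → (C.s * w + C′.s * w) + ((b + b′) + t)) (sym (sumIdx-+ C.K C′.K))))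
      }
      where module C = Certificate C
            module C′ = Certificate C′
    scale : ∀ {c r} → 0ℚ ≤ c → Certificate A w r → Certificate A w (c *ᵣ r)
    scale {c} {a , b} 0≤c C = record
      { K = λ α → c * C.K α ; s = c * C.s
      ; K≥0 = λ α → *-nonNeg 0≤c (C.K≥0 α) ; s≥0 = *-nonNeg 0≤c C.s≥0
      ; supported = λ α off → trans (cong (c *_) (C.supported α off)) (*-zeroʳ c)
      ; hypSum-bound = λ i j → subst (_≤ c * C.s)
          (trans (*-distribˡ-+ c (hypSum C.K i j) (a (combine i j)))
                 (cong (_+ c * a (combine i j)) (sym (hypSum-*ˡ c C.K i j))))
          (*-mono-≤-nonNeg 0≤c (C.hypSum-bound i j))
      ; total-bound = subst₂ _≤_ (sym (*-assoc c C.s w))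
          (trans (*-distribˡ-+ c b (total C.K)) (cong (c * b +_) (sym (sumIdx-*ˡ c C.K))))
          (*-mono-≤-nonNeg 0≤c C.total-bound)
      }
      where module C = Certificate C

  signRow : Fin k → Row k
  signRow l = (λ k → - [ l ≟ k ]ℚ) , 0ℚ

  weightRow : ∀ k → ℚ → Row k
  weightRow k w = (λ _ → 1ℚ) , w

  -- A lower bound is written as an upper one by negation; a zero of A contributes the trivial row 0
  -- ≤ 0, so that the list can run over all indices.
  coverRow : Matrix01 d n → Index d n → Row (d ℕ.* n)
  coverRow {d} {n} A α =
    if A (canon α) then ((λ k → let (i , j) = remQuot n k in - [ α i ≟ j ]ℚ) , - 1ℚ) else ((λ _ → 0ℚ) , 0ℚ)

  coveringSystem : Matrix01 d n → ℚ → List (Row (d ℕ.* n))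
  coveringSystem {d} {n} A w =
    weightRow (d ℕ.* n) w ∷ map signRow (allFin (d ℕ.* n)) ++ map (coverRow A) (allIndices d n)

  []ℚ-nonNeg : (i j : Fin n) → 0ℚ ≤ [ i ≟ j ]ℚ
  []ℚ-nonNeg i j with i ≟ j
  ... | yes _ = nonNegative⁻¹ 1ℚ
  ... | no _  = ≤-refl

  zero-certificate : (A : Matrix01 d n) (w : ℚ) {r : Row (d ℕ.* n)} →
                     (∀ l → proj₁ r l ≤ 0ℚ) → 0ℚ ≤ proj₂ r → Certificate A w r
  zero-certificate {d} {n} A w {a , b} a≤0 b≥0 = record
    { K = λ _ → 0ℚ ; s = 0ℚ ; K≥0 = λ _ → ≤-refl ; s≥0 = ≤-refl ; supported = λ _ _ → refl
    ; hypSum-bound = λ i j → +-mono-≤ (≤-reflexive (hypSum-zero d n i j)) (a≤0 (combine i j))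
    ; total-bound = subst₂ _≤_ (sym (*-zeroˡ w)) (sym (trans (cong (b +_) (sumIdx-zero d n)) (+-identityʳ b))) b≥0
    }

  coveringSystem-certified : (A : Matrix01 d n) (w : ℚ) → All (Certificate A w) (coveringSystem A w)
  coveringSystem-certified {d} {n} A w =
    record { K = λ _ → 0ℚ ; s = 1ℚ ; K≥0 = λ _ → ≤-refl ; s≥0 = nonNegative⁻¹ 1ℚ ; supported = λ _ _ → refl
           ; hypSum-bound = λ i j → ≤-reflexive (cong (_+ 1ℚ) (hypSum-zero d n i j))
           ; total-bound = ≤-reflexive (trans (*-identityˡ w)
               (sym (trans (cong (w +_) (sumIdx-zero d n)) (+-identityʳ w))))
           } ∷
    All.++⁺ (All.map⁺ (All.universal (λ l → zero-certificate A w (λ k → neg-antimono-≤ ([]ℚ-nonNeg l k)) ≤-refl)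
                         (allFin (d ℕ.* n))))
            (All.map⁺ (All.universal cover (allIndices d n)))
    where
    cover : ∀ α → Certificate A w (coverRow A α)
    cover α with A (canon α) in on
    ... | false = zero-certificate A w (λ _ → ≤-refl) ≤-refl
    ... | true  = record
      { K = indicator α ; s = 0ℚ ; K≥0 = indicator-nonNeg α ; s≥0 = ≤-refl
      ; supported = λ β off → indicator-off α (canon β) λ β≗α →
          true≢false (trans (sym on)
            (trans (cong A (sym (canon-cong (λ i → trans (sym (canon-≗ β i)) (β≗α i))))) off))
      ; hypSum-bound = λ i j → ≤-reflexive (trans
          (cong₂ _+_ (hypSum-indicator α i j) (cong (λ (i , j) → - [ α i ≟ j ]ℚ) (remQuot-combine i j)))
          (+-inverseʳ [ α i ≟ j ]ℚ))
      ; total-bound = ≤-reflexive (trans (*-zeroˡ w) (sym (cong (- 1ℚ +_) (total-indicator α))))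
      }
      where
      true≢false : true ≢ false
      true≢false ()

  IsMaxWeight : Matrix01 d n → ℚ → Set
  IsMaxWeight A w = ∀ K W → IsPolyplex K W → Contains A K → W ≤ w

  -- A contradiction yields a supported K with hyperplane sums at most s and total above s w. If s
  -- is positive, K / s is a polyplex in A heavier than w; if s is 0, the hyperplanes of a single
  -- direction already force the total down to 0.
  coveringSystem-consistent : (A : Matrix01 (suc d) n) (w : ℚ) → IsMaxWeight A w → ¬ Infeasible (Certificate A w)
  coveringSystem-consistent {d} {n} A w max ((a , b) , C , a≡0 , b<0) = <-irrefl refl (begin-strict
    total K     ≤⟨ total≤ (<-cmp 0ℚ s) ⟩
    s * w       ≤⟨ total-bound ⟩
    b + total K <⟨ +-monoˡ-< (total K) b<0 ⟩
    0ℚ + total K ≡⟨ +-identityˡ (total K) ⟩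
    total K     ∎)
    where
    open Certificate C
    open ≤-Reasoning
    hypSum≤s : ∀ i j → hypSum K i j ≤ s
    hypSum≤s i j = subst (_≤ s) (trans (cong (hypSum K i j +_) (a≡0 (combine i j))) (+-identityʳ _)) (hypSum-bound i j)
    total≤ : _ → total K ≤ s * w
    total≤ (tri> _ _ s<0) = ⊥-elim (<-irrefl refl (<-≤-trans s<0 s≥0))
    total≤ (tri≈ _ 0≡s _) = begin
      total K                      ≡⟨ total-hypSum K ⟩
      sumFin n (hypSum K zero)     ≤⟨ sumFin-mono (hypSum≤s zero) ⟩
      sumFin n (λ _ → s)           ≡⟨ sumFin-cong {k = n} (λ _ → sym 0≡s) ⟩
      sumFin n (λ _ → 0ℚ)          ≡⟨ sumFin-zero n ⟩
      0ℚ                           ≡⟨ *-zeroˡ w ⟨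
      0ℚ * w                       ≡⟨ cong (_* w) 0≡s ⟩
      s * w                        ∎
    total≤ (tri< 0<s _ _) = begin
      total K                      ≡⟨ s*1/s (total K) ⟨
      s * (1/ s * total K)
        ≤⟨ *-mono-≤-nonNeg s≥0 (max K′ (1/ s * total K) (K′≥0 , hyp≤1 , total≡) (restrict-contained A _)) ⟩
      s * w                        ∎
      where
      instance _ = positive 0<s
               _ = pos⇒nonZero s
      1/s≥0 : 0ℚ ≤ 1/ s
      1/s≥0 = <⇒≤ (positive⁻¹ (1/ s) {{1/pos⇒pos s}})
      s*1/s : ∀ x → s * (1/ s * x) ≡ x
      s*1/s x = trans (sym (*-assoc s (1/ s) x)) (trans (cong (_* x) (*-inverseʳ s)) (*-identityˡ x))
      K″ K′ : QMatrix (suc d) n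
      K″ α = 1/ s * K α
      K′ = restrict A K″
      K′≡K″ : ∀ α → K′ (canon α) ≡ K″ (canon α)
      K′≡K″ = restrict-canon A K″ (λ α off → trans (cong (1/ s *_) (supported α off)) (*-zeroʳ (1/ s)))
      K′≥0 = restrict-nonNeg A {K″} (λ α → *-nonNeg 1/s≥0 (K≥0 α))
      total≡ : total K′ ≡ 1/ s * total K
      total≡ = trans (sumIdx-cong {f = K′} {g = K″} K′≡K″) (sumIdx-*ˡ (1/ s) K)
      hyp≤1 : ∀ i j → hypSum K′ i j ≤ 1ℚ
      hyp≤1 i j = begin
        hypSum K′ i j          ≡⟨ hypSum-cong {K = K′} {L = K″} K′≡K″ i j ⟩
        hypSum K″ i j          ≡⟨ hypSum-*ˡ (1/ s) K i j ⟩
        1/ s * hypSum K i j    ≤⟨ *-mono-≤-nonNeg 1/s≥0 (hypSum≤s i j) ⟩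
        1/ s * s               ≡⟨ *-inverseˡ s ⟩
        1ℚ                     ∎

  dot-unit : (l : Fin k) (y : Fin k → ℚ) → dot (λ k → - [ l ≟ k ]ℚ) y ≡ - y l
  dot-unit l y = trans
    (sumFin-single l (λ k → - [ l ≟ k ]ℚ * y k) λ k k≢l →
      trans (cong (λ x → - x * y k) (if-≟-no (k≢l ∘ sym))) (*-zeroˡ (y k)))
    (trans (cong (λ x → - x * y l) (if-≟-yes l)) (solve 1 (λ y → con (- 1ℚ) :* y := :- y) refl (y l)))

  record FractionalCover (A : Matrix01 d n) (w : ℚ) : Set where
    field
      lam    : Fin d → Fin n → ℚ
      lam≥0  : ∀ i j → 0ℚ ≤ lam i j
      covers : ∀ α → A (canon α) ≡ true → 1ℚ ≤ weight lam α
      light  : totalWeight lam ≤ w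

  fractionalCover : (A : Matrix01 (suc d) n) (w : ℚ) → IsMaxWeight A w → FractionalCover A w
  fractionalCover {d-1} {n} A w max
    with farkas (certificate-isCone A w) (coveringSystem-certified A w)
  ... | inj₂ infeasible = ⊥-elim (coveringSystem-consistent A w max infeasible)
  ... | inj₁ (y , weight-sat ∷ sats) = record { lam = lam ; lam≥0 = lam≥0 ; covers = covers ; light = light }
    where
    D = suc d-1
    open ≡-Reasoning
    lam : Fin D → Fin n → ℚ
    lam i j = y (combine i j)
    lam≥0 : ∀ i j → 0ℚ ≤ lam i j
    lam≥0 i j = neg-cancel (subst (_≤ 0ℚ) (dot-unit l y)
      (All.lookup (All.map⁻ (All.++⁻ˡ (map signRow (allFin (D ℕ.* n))) sats)) (∈-allFin l)))
      where
      l = combine i j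
      neg-cancel : ∀ {x} → - x ≤ 0ℚ → 0ℚ ≤ x
      neg-cancel {x} -x≤0 = subst (0ℚ ≤_) (neg-involutive x) (neg-antimono-≤ -x≤0)
        where neg-involutive = solve 1 (λ x → :- (:- x) := x) refl
    light : totalWeight lam ≤ w
    light = subst (_≤ w) (trans (sumFin-cong (λ l → *-identityˡ (y l))) (sumFin-combine D n y)) weight-sat
    cover-sat : ∀ α → Sat y (coverRow A (canon α))
    cover-sat α = All.lookup (All.map⁻ (All.++⁻ʳ (map signRow (allFin (D ℕ.* n))) sats)) (canon∈allIndices α)
    dot-cover : ∀ α → dot (λ k → let (i , j) = remQuot n k in - [ α i ≟ j ]ℚ) y ≡ - 1ℚ * weight lam α
    dot-cover α = begin
      dot (λ k → let (i , j) = remQuot n k in - [ α i ≟ j ]ℚ) y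
        ≡⟨ sumFin-combine D n (λ k → let (i , j) = remQuot n k in - [ α i ≟ j ]ℚ * y k) ⟩
      sumFin D (λ i → sumFin n (λ j → let (i′ , j′) = remQuot n (combine i j) in - [ α i′ ≟ j′ ]ℚ * lam i j))
        ≡⟨ sumFin-cong (λ i → trans (sumFin-cong (λ j →
             cong (λ (i′ , j′) → - [ α i′ ≟ j′ ]ℚ * lam i j) (remQuot-combine i j))) (dot-unit (α i) (lam i))) ⟩
      sumFin D (λ i → - lam i (α i))
        ≡⟨ sumFin-cong (λ i → solve 1 (λ x → :- x := con (- 1ℚ) :* x) refl (lam i (α i))) ⟩
      sumFin D (λ i → - 1ℚ * lam i (α i))
        ≡⟨ sumFin-*ˡ (- 1ℚ) (λ i → lam i (α i)) ⟩
      - 1ℚ * weight lam α ∎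
    sat⇒covers : ∀ α → A (canon α) ≡ true → Sat y (coverRow A α) → 1ℚ ≤ weight lam α
    sat⇒covers α on sat with A (canon α)
    sat⇒covers α refl sat | true = ≤-by-balance sat
      (trans (solve 1 (λ x → con (- 1ℚ) :+ con 1ℚ := (con (- 1ℚ) :* x) :+ x) refl (weight lam α))
             (cong (_+ weight lam α) (sym (dot-cover α))))
    covers : ∀ α → A (canon α) ≡ true → 1ℚ ≤ weight lam α
    covers α on = subst (1ℚ ≤_) (weight-cong lam (canon-≗ α))
      (sat⇒covers (canon α) (trans (cong A (canon-cong (canon-≗ α))) on) (cover-sat α))

  -- Natural numbers as rationals; duality for integral tables

  -- Division by 1 normalises through a gcd and is stuck on a variable n; sums and order are
  -- therefore read off the explicit fraction.
  ℕtoℚ≡mkℚ : ∀ n → ℕtoℚ n ≡ mkℚ (ℤ.+ n) 0 (Coprime.sym (Coprime.1-coprimeTo n))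
  ℕtoℚ≡mkℚ n = ↥p/↧p≡p (mkℚ (ℤ.+ n) 0 (Coprime.sym (Coprime.1-coprimeTo n)))

  ℕtoℚ-+ : ∀ m n → ℕtoℚ (m ℕ.+ n) ≡ ℕtoℚ m + ℕtoℚ n
  ℕtoℚ-+ m n = sym (trans (cong₂ _+_ (ℕtoℚ≡mkℚ m) (ℕtoℚ≡mkℚ n))
    (cong (_/ 1) (cong₂ ℤ._+_ (ℤ.*-identityʳ (ℤ.+ m)) (ℤ.*-identityʳ (ℤ.+ n)))))

  ℕtoℚ-cancel-≤ : ∀ {m n} → ℕtoℚ m ≤ ℕtoℚ n → m ℕ.≤ n
  ℕtoℚ-cancel-≤ {m} {n} m≤n = ℤ.drop‿+≤+ (subst₂ ℤ._≤_ (ℤ.*-identityʳ (ℤ.+ m)) (ℤ.*-identityʳ (ℤ.+ n))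
    (drop-*≤* (subst₂ _≤_ (ℕtoℚ≡mkℚ m) (ℕtoℚ≡mkℚ n) m≤n)))

  ℕtoℚ-mono-≤ : ∀ {m n} → m ℕ.≤ n → ℕtoℚ m ≤ ℕtoℚ n
  ℕtoℚ-mono-≤ {m} {n} m≤n = subst₂ _≤_ (sym (ℕtoℚ≡mkℚ m)) (sym (ℕtoℚ≡mkℚ n))
    (*≤* (subst₂ ℤ._≤_ (sym (ℤ.*-identityʳ (ℤ.+ m))) (sym (ℤ.*-identityʳ (ℤ.+ n))) (ℤ.+≤+ m≤n)))

  ℕtoℚ-nonNeg : ∀ n → 0ℚ ≤ ℕtoℚ n
  ℕtoℚ-nonNeg n = ℕtoℚ-mono-≤ {0} {n} ℕ.z≤n

  ℕtoℚ-sum : (f : Fin k → ℕ) → ℕtoℚ (sum f) ≡ sumFin k (ℕtoℚ ∘ f)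
  ℕtoℚ-sum {zero}  f = refl
  ℕtoℚ-sum {suc k} f = trans (ℕtoℚ-+ (f zero) (sum (f ∘ suc))) (cong (ℕtoℚ (f zero) +_) (ℕtoℚ-sum (f ∘ suc)))

  sumFin-const : ∀ k p → sumFin k (λ _ → p) ≡ ℕtoℚ k * p
  sumFin-const zero    p = sym (*-zeroˡ p)
  sumFin-const (suc k) p = trans (cong (p +_) (sumFin-const k p))
    (trans (solve 2 (λ k p → p :+ k :* p := (con 1ℚ :+ k) :* p) refl (ℕtoℚ k) p)
           (cong (_* p) (sym (ℕtoℚ-+ 1 k))))

  sumFin-nonNeg : {f : Fin k → ℚ} → (∀ i → 0ℚ ≤ f i) → 0ℚ ≤ sumFin k f
  sumFin-nonNeg {k} f≥0 = subst (_≤ sumFin k _) (sumFin-zero k) (sumFin-mono f≥0)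

  term≤sumFin : {f : Fin k → ℚ} → (∀ i → 0ℚ ≤ f i) → ∀ i → f i ≤ sumFin k f
  term≤sumFin {suc k} {f} f≥0 zero = subst (_≤ f zero + sumFin k (f ∘ suc)) (+-identityʳ (f zero))
    (+-monoʳ-≤ (f zero) (sumFin-nonNeg (f≥0 ∘ suc)))
  term≤sumFin {suc k} {f} f≥0 (suc i) = subst (_≤ f zero + sumFin k (f ∘ suc)) (+-identityˡ (f (suc i)))
    (+-mono-≤ (f≥0 zero) (term≤sumFin (f≥0 ∘ suc) i))

  abstract
    minimiser : (f : Fin (suc n) → ℚ) → ∃ λ i → ∀ j → f i ≤ f j
    minimiser f = argmin f zero (allFin _) ,
      λ j → All.lookup (f[argmin]≤f[xs] {f = f} zero (allFin _)) (∈-allFin j)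

  -- The table c counts every unit of the polyplex at least twice, so its total is at least 2(n -
  -- δ); as 2δ is the natural number W, the bound returns to ℕ.
  half-deficiency-duality : (A : Matrix01 d n) (K : QMatrix d n) {δ : ℚ} {W : ℕ} → δ + δ ≡ ℕtoℚ W →
    IsPolyplex K (ℕtoℚ n - δ) → Contains A K →
    (c : Fin d → Fin n → ℕ) → Covers A c → n ℕ.+ n ℕ.≤ sum (λ i → sum (c i)) ℕ.+ W
  half-deficiency-duality {d} {n} A K {δ} {W} 2δ≡W (K≥0 , hyp≤1 , total≡) A⊇K c covers =
    ℕtoℚ-cancel-≤ (subst₂ _≤_ (sym (ℕtoℚ-+ n n)) (sym (ℕtoℚ-+ C W)) (≤-by-balance two-total≤
      (trans (solve 3 (λ n δ c → c :+ (n :+ n) := (con (1ℚ + 1ℚ)) :* (n :- δ) :+ (c :+ (δ :+ δ))) refl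
                (ℕtoℚ n) δ (ℕtoℚ C))
             (cong₂ (λ t w → (1ℚ + 1ℚ) * t + (ℕtoℚ C + w)) (sym total≡) 2δ≡W))))
    where
    C : ℕ
    C = sum (λ i → sum (c i))
    lam : Fin d → Fin n → ℚ
    lam i j = ℕtoℚ (c i j)
    pointwise : ∀ α → (1ℚ + 1ℚ) * K (canon α) ≤ weight lam (canon α) * K (canon α)
    pointwise α with K (canon α) ℚ.≟ 0ℚ
    ... | yes K≡0 = ≤-reflexive (trans (trans (cong ((1ℚ + 1ℚ) *_) K≡0) (*-zeroʳ (1ℚ + 1ℚ)))
                      (sym (trans (cong (weight lam (canon α) *_) K≡0) (*-zeroʳ (weight lam (canon α))))))
    ... | no K≢0  = subst₂ _≤_ (*-comm (K (canon α)) (1ℚ + 1ℚ)) (*-comm (K (canon α)) (weight lam (canon α)))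
      (*-mono-≤-nonNeg (K≥0 (canon α)) (subst (1ℚ + 1ℚ ≤_)
        (trans (ℕtoℚ-sum (λ i → c i (α i))) (weight-cong lam (sym ∘ canon-≗ α)))
        (ℕtoℚ-mono-≤ (covers α (A⊇K (canon α) K≢0)))))
    two-total≤ : (1ℚ + 1ℚ) * total K ≤ ℕtoℚ C
    two-total≤ = begin
      (1ℚ + 1ℚ) * total K                          ≡⟨ sumIdx-*ˡ (1ℚ + 1ℚ) K ⟨
      sumIdx d n (λ α → (1ℚ + 1ℚ) * K α)           ≤⟨ sumIdx-mono pointwise ⟩
      sumIdx d n (λ α → weight lam α * K α)        ≤⟨ sumIdx-weight-≤ lam (λ i j → ℕtoℚ-nonNeg (c i j)) K hyp≤1 ⟩
      totalWeight lam                              ≡⟨ sumFin-cong (λ i → ℕtoℚ-sum (c i)) ⟨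
      sumFin d (λ i → ℕtoℚ (sum (c i)))            ≡⟨ ℕtoℚ-sum (λ i → sum (c i)) ⟨
      ℕtoℚ C                                       ∎
      where open ≤-Reasoning

  -- The cover at zeros of an extremal matrix

  setOne-true : (A : Matrix01 d n) (α β : Index d n) → setOne A α β ≡ true → β ≗ α ⊎ A β ≡ true
  setOne-true A α β on with all? (λ i → β i ≟ α i)
  ... | yes β≗α = inj₁ β≗α
  ... | no _    = inj₂ on

  -- A polydiagonal of A with α added has weight n, while the cover accounts only for n - δ of it; the
  -- excess must come from the entry α, whose hyperplane carries at most 1.
  zero-weight : (A : Matrix01 (suc d) n) {δ : ℚ} → 0ℚ < δ → (cover : FractionalCover A (ℕtoℚ n - δ)) →
    ∀ α → ContainsPolydiagonal (setOne A α) → weight (FractionalCover.lam cover) α ≤ 1ℚ - δ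
  zero-weight {d} {n} A {δ} 0<δ cover α (K , (K≥0 , hyp≤1 , total≡) , A⁺⊇K) = conclude (⊔-sel 0ℚ (1ℚ - ω))
    where
    open FractionalCover cover
    ω g : ℚ
    ω = weight lam α
    -- The amount by which α falls short of being covered. Truncation at 0 lets it multiply the
    -- whole hyperplane `slice`, whose sum is at most 1, instead of the single entry α.
    g = 0ℚ ⊔ (1ℚ - ω)
    g≥0 : 0ℚ ≤ g
    g≥0 = p≤p⊔q 0ℚ (1ℚ - ω)
    slice : QMatrix (suc d) n
    slice β = if ⌊ β zero ≟ α zero ⌋ then K β else 0ℚ
    slice≥0 : ∀ β → 0ℚ ≤ slice β
    slice≥0 β with β zero ≟ α zero
    ... | yes _ = K≥0 β
    ... | no _  = ≤-refl
    pointwise : ∀ β′ → let β = canon β′ in K β ≤ weight lam β * K β + g * slice β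
    pointwise β′ with K (canon β′) ℚ.≟ 0ℚ
    ... | yes K≡0 = subst (λ x → x ≤ weight lam (canon β′) * x + g * slice (canon β′)) (sym K≡0)
      (subst (0ℚ ≤_) (cong (_+ g * slice (canon β′)) (sym (*-zeroʳ (weight lam (canon β′)))))
        (subst (0ℚ ≤_) (sym (+-identityˡ _)) (*-nonNeg g≥0 (slice≥0 (canon β′)))))
    ... | no K≢0 with setOne-true A α (canon β′) (A⁺⊇K (canon β′) K≢0)
    ...   | inj₁ β≗α = subst (λ x → Kβ ≤ weight lam β * Kβ + g * x) (sym slice≡)
      (≤-by-balance (*-mono-≤-nonNeg (K≥0 β) (p≤q⊔p 0ℚ (1ℚ - ω)))
        (trans (solve 3 (λ k g w → k :* g :+ k := k :* (con 1ℚ :- w) :+ (w :* k :+ g :* k)) refl Kβ g ω)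
               (cong (λ w → Kβ * (1ℚ - ω) + (w * Kβ + g * Kβ)) (weight-cong lam (sym ∘ β≗α)))))
      where
      β = canon β′
      Kβ = K β
      slice≡ : slice β ≡ Kβ
      slice≡ = trans (cong (λ l → if ⌊ β zero ≟ l ⌋ then Kβ else 0ℚ) (sym (β≗α zero))) (if-≟-yes (β zero))
    ...   | inj₂ on = ≤-by-balance
      (+-mono-≤ (*-mono-≤-nonNeg (K≥0 β) (subst (1ℚ ≤_) (weight-cong lam (sym ∘ canon-≗ β′)) (covers β′ on)))
                (*-nonNeg g≥0 (slice≥0 β)))
      (solve 4 (λ k w g s → (k :* w :+ g :* s) :+ k := (k :* con 1ℚ :+ con 0ℚ) :+ (w :* k :+ g :* s)) refl
        (K β) (weight lam β) g (slice β))
      where β = canon β′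
    n≤ : ℕtoℚ n ≤ (ℕtoℚ n - δ) + g
    n≤ = begin
      ℕtoℚ n                                                         ≡⟨ total≡ ⟨
      total K
        ≤⟨ sumIdx-mono {f = K} {g = λ β → weight lam β * K β + g * slice β} pointwise ⟩
      sumIdx (suc d) n (λ β → weight lam β * K β + g * slice β)
        ≡⟨ trans (sumIdx-+ (λ β → weight lam β * K β) (λ β → g * slice β))
                 (cong (sumIdx (suc d) n (λ β → weight lam β * K β) +_) (sumIdx-*ˡ g slice)) ⟩
      sumIdx (suc d) n (λ β → weight lam β * K β) + g * hypSum K zero (α zero)
        ≤⟨ +-mono-≤ (≤-trans (sumIdx-weight-≤ lam lam≥0 K hyp≤1) light)
                    (*-mono-≤-nonNeg g≥0 (hyp≤1 zero (α zero))) ⟩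
      (ℕtoℚ n - δ) + g * 1ℚ                                          ≡⟨ cong ((ℕtoℚ n - δ) +_) (*-identityʳ g) ⟩
      (ℕtoℚ n - δ) + g                                               ∎
      where open ≤-Reasoning
    δ≤g : δ ≤ g
    δ≤g = ≤-by-balance n≤ (solve 3 (λ n δ g → ((n :- δ) :+ g) :+ δ := n :+ g) refl (ℕtoℚ n) δ g)
    conclude : g ≡ 0ℚ ⊎ g ≡ 1ℚ - ω → ω ≤ 1ℚ - δ
    conclude (inj₁ g≡0) = ⊥-elim (<-irrefl refl (<-≤-trans 0<δ (subst (δ ≤_) g≡0 δ≤g)))
    conclude (inj₂ g≡)  = ≤-by-balance (subst (δ ≤_) g≡ δ≤g)
      (solve 2 (λ δ w → (con 1ℚ :- w) :+ w := δ :+ (con 1ℚ :- δ)) refl δ ω)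

  -- Rounding a cover with a gap

  -- If no choice of columns gives a weight strictly between ½ and 1, then columns of weight below ½
  -- can be added one at a time without ever jumping over the gap.
  Gap : ℚ → (Fin d → Fin n → ℚ) → Set
  Gap c x = ∀ γ → c + weight x γ < 1ℚ → c + weight x γ ≤ ½

  HasZeros : (Fin d → Fin n → ℚ) → Set
  HasZeros x = ∀ i → ∃ λ j → x i j ≡ 0ℚ

  gap-absorb : ∀ c (x : Fin (suc d) → Fin n → ℚ) → Gap c x → ∀ j → Gap (c + x zero j) (x ∘ suc)
  gap-absorb c x gap j γ = subst (λ w → w < 1ℚ → w ≤ ½)
    (sym (+-assoc c (x zero j) (weight (x ∘ suc) γ))) (gap (j ∷ᶠ γ))

  -- Filling the other directions with zero columns turns the gap for indices into one for single
  -- columns.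
  gap-single : ∀ c (x : Fin d → Fin n → ℚ) → Gap c x → HasZeros x →
               ∀ i j → c + x i j < 1ℚ → c + x i j ≤ ½
  gap-single {d} {n} c x gap zeros i j = subst (λ w → c + w < 1ℚ → c + w ≤ ½) weight≡ (gap γ)
    where
    γ : Index d n
    γ l = if ⌊ l ≟ i ⌋ then j else proj₁ (zeros l)
    γ-i : γ i ≡ j
    γ-i with i ≟ i
    ... | yes _  = refl
    ... | no i≢i = ⊥-elim (i≢i refl)
    γ-other : ∀ l → l ≢ i → x l (γ l) ≡ 0ℚ
    γ-other l l≢i with l ≟ i
    ... | yes l≡i = ⊥-elim (l≢i l≡i)
    ... | no _    = proj₂ (zeros l)
    weight≡ : weight x γ ≡ x i j
    weight≡ = trans (sumFin-single i (λ l → x l (γ l)) γ-other) (cong (x i) γ-i)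

  ½+½-< : ∀ {p q} → p ≤ ½ → q < ½ → p + q < 1ℚ
  ½+½-< p≤½ q<½ = +-mono-≤-< p≤½ q<½

  gap-all-small : ∀ c (x : Fin d → Fin n → ℚ) → Gap c x → HasZeros x → c ≤ ½ →
                  ∀ β → (∀ i → x i (β i) < ½) → c + weight x β ≤ ½
  gap-all-small {zero}  c x gap zeros c≤½ β small = subst (_≤ ½) (sym (+-identityʳ _)) c≤½
  gap-all-small {suc d} c x gap zeros c≤½ β small = subst (_≤ ½)
    (+-assoc c (x zero (β zero)) (weight (x ∘ suc) (β ∘ suc)))
    (gap-all-small (c + x zero (β zero)) (x ∘ suc) (gap-absorb c x gap (β zero)) (zeros ∘ suc)
      (gap-single c x gap zeros zero (β zero) (½+½-< c≤½ (small zero))) (β ∘ suc) (small ∘ suc))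

  -- While a small column is absorbed ahead of the large one, the bound on the large one survives: c
  -- plus the large column is at most ½ by the gap, and the small one adds less than ½.
  gap-one-large : ∀ c (x : Fin d → Fin n → ℚ) → Gap c x → HasZeros x →
                  ∀ β i → c + x i (β i) < 1ℚ → (∀ l → l ≢ i → x l (β l) < ½) → c + weight x β ≤ ½
  gap-one-large c x gap zeros β zero below small = subst (_≤ ½)
    (+-assoc c (x zero (β zero)) (weight (x ∘ suc) (β ∘ suc)))
    (gap-all-small (c + x zero (β zero)) (x ∘ suc) (gap-absorb c x gap (β zero)) (zeros ∘ suc)
      (gap-single c x gap zeros zero (β zero) below) (β ∘ suc) (λ l → small (suc l) λ ()))
  gap-one-large c x gap zeros β (suc i) below small = subst (_≤ ½)
    (+-assoc c (x zero (β zero)) (weight (x ∘ suc) (β ∘ suc)))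
    (gap-one-large (c + x zero (β zero)) (x ∘ suc) (gap-absorb c x gap (β zero)) (zeros ∘ suc) (β ∘ suc) i
      (subst (_< 1ℚ) (solve 3 (λ c p q → (c :+ q) :+ p := (c :+ p) :+ q) refl
                        c (x zero (β zero)) (x (suc i) (β (suc i))))
        (½+½-< (gap-single c x gap zeros (suc i) (β (suc i)) below) (small zero λ ())))
      (λ l l≢i → small (suc l) (l≢i ∘ suc-injective)))

  -- Here c is the weight that every index has anyway and p the surplus of a column. A full covers
  -- together with c alone; the threshold between half and none concerns p itself, because the gap
  -- lemmas add surpluses below ½.
  data Graded (c p : ℚ) : Score → Set where
    is-full : 1ℚ ≤ c + p → Graded c p full
    is-half : c + p < 1ℚ → ½ ≤ p → Graded c p half
    is-none : c + p < 1ℚ → p < ½ → Graded c p none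

  abstract
    grade : ∀ c p → ∃ (Graded c p)
    grade c p with 1ℚ ≤? c + p | ½ ≤? p
    ... | yes 1≤ | _       = full , is-full 1≤
    ... | no 1≰  | yes ½≤p = half , is-half (≰⇒> 1≰) ½≤p
    ... | no 1≰  | no ½≰p  = none , is-none (≰⇒> 1≰) (≰⇒> ½≰p)

  module _ {c p : ℚ} where

    graded-none : ∀ {s} → Graded c p s → value s ≡ 0 → p < ½
    graded-none (is-none _ p<½) _ = p<½

    graded-not-full : ∀ {s} → Graded c p s → value s ℕ.< 2 → c + p < 1ℚ
    graded-not-full (is-full _)    2<2 = ⊥-elim (ℕ.<-irrefl refl 2<2)
    graded-not-full (is-half <1 _) _   = <1
    graded-not-full (is-none <1 _) _   = <1

    value≤-unless-full : ∀ {s} → Graded c p s → 0ℚ ≤ p → c + p < 1ℚ → ℕtoℚ (value s) ≤ p + p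
    value≤-unless-full (is-full 1≤)    p≥0 <1 = ⊥-elim (<-irrefl refl (<-≤-trans <1 1≤))
    value≤-unless-full (is-half _ ½≤p) p≥0 <1 = +-mono-≤ ½≤p ½≤p
    value≤-unless-full (is-none _ _)   p≥0 <1 = +-nonNeg p≥0 p≥0

    -- A full guarantees only p ≥ 1 - c, so its value 2 may exceed 2p; the factor 1 - c compensates
    -- and is divided out in `score-light`.
    scaled-value≤ : ∀ {s} → Graded c p s → 0ℚ ≤ c → 0ℚ ≤ p → (1ℚ - c) * ℕtoℚ (value s) ≤ p + p
    scaled-value≤ (is-full 1≤)    c≥0 p≥0 = ≤-by-balance (+-mono-≤ 1≤ 1≤)
      (solve 2 (λ c p → ((c :+ p) :+ (c :+ p)) :+ (con 1ℚ :- c) :* con (ℕtoℚ 2) :=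
                        con (1ℚ + 1ℚ) :+ (p :+ p)) refl c p)
    scaled-value≤ (is-half _ ½≤p) c≥0 p≥0 = ≤-by-balance (+-mono-≤ c≥0 (+-mono-≤ ½≤p ½≤p))
      (solve 2 (λ c p → (c :+ (p :+ p)) :+ (con 1ℚ :- c) :* con 1ℚ := con (0ℚ + (½ + ½)) :+ (p :+ p)) refl c p)
    scaled-value≤ (is-none _ _)   c≥0 p≥0 = subst (_≤ p + p) (sym (*-zeroʳ (1ℚ - c))) (+-nonNeg p≥0 p≥0)

  ℕtoℚ-countAt : (S : Scores d n) (α : Index d n) →
                 ℕtoℚ (countAt value S α) ≡ weight (λ i j → ℕtoℚ (value (S i j))) α
  ℕtoℚ-countAt S α = ℕtoℚ-sum (λ i → value (S i (α i)))

  ½≤½ : ½ ≤ ½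
  ½≤½ = ≤-refl

  ½<1 : ½ < 1ℚ
  ½<1 = from-yes (½ <? 1ℚ)

  ½≤1 : ½ ≤ 1ℚ
  ½≤1 = <⇒≤ ½<1

  -- Moving the minimum `μ i` of each direction into c creates the zero columns that `gap-single`
  -- needs. The zero `α⁰` of A shows that c ≤ ½, hence that 1 - c is positive.
  module Rounding (A : Matrix01 (suc d) (suc m)) {δ : ℚ} {W : ℕ} (2δ≡W : δ + δ ≡ ℕtoℚ W) (½≤δ : ½ ≤ δ)
    (cover : FractionalCover A (ℕtoℚ (suc m) - δ))
    (zeros-light : ∀ α → A α ≡ false → weight (FractionalCover.lam cover) α ≤ 1ℚ - δ)
    (α⁰ : Index (suc d) (suc m)) (α⁰-off : A α⁰ ≡ false) where

    open FractionalCover cover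

    least : Fin (suc d) → Fin (suc m)
    least i = proj₁ (minimiser (lam i))

    μ : Fin (suc d) → ℚ
    μ i = lam i (least i)

    c : ℚ
    c = sumFin (suc d) μ

    x : Fin (suc d) → Fin (suc m) → ℚ
    x i j = lam i j - μ i

    c≥0 : 0ℚ ≤ c
    c≥0 = sumFin-nonNeg (λ i → lam≥0 i (least i))

    x≥0 : ∀ i j → 0ℚ ≤ x i j
    x≥0 i j = ≤-by-balance (proj₂ (minimiser (lam i)) j)
      (solve 2 (λ l u → l :+ con 0ℚ := u :+ (l :- u)) refl (lam i j) (μ i))

    weight-x : ∀ α → weight lam α ≡ c + weight x α
    weight-x α = trans (sumFin-cong (λ i → solve 2 (λ l u → l := u :+ (l :- u)) refl (lam i (α i)) (μ i)))
                       (sumFin-+ μ (λ i → x i (α i)))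

    off-light : ∀ α → A α ≡ false → c + weight x α ≤ 1ℚ - δ
    off-light α off = subst (_≤ 1ℚ - δ) (weight-x α) (zeros-light α off)

    on-heavy : ∀ α → A (canon α) ≡ true → 1ℚ ≤ c + weight x α
    on-heavy α on = subst (1ℚ ≤_) (weight-x α) (covers α on)

    1-δ≤½ : 1ℚ - δ ≤ ½
    1-δ≤½ = ≤-by-balance ½≤δ (solve 1 (λ δ → δ :+ (con 1ℚ :- δ) := con ½ :+ con ½) refl δ)

    gap : Gap c x
    gap γ <1 with A (canon γ) in eq
    ... | true  = ⊥-elim (<-irrefl refl (<-≤-trans <1 (on-heavy γ eq)))
    ... | false = ≤-trans (subst (λ w → c + w ≤ 1ℚ - δ) (weight-cong x (canon-≗ γ)) (off-light (canon γ) eq)) 1-δ≤½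

    zeros : HasZeros x
    zeros i = least i , +-inverseʳ (μ i)

    S : Scores (suc d) (suc m)
    S i j = proj₁ (grade c (x i j))

    graded : ∀ i j → Graded c (x i j) (S i j)
    graded i j = proj₂ (grade c (x i j))

    -- At a zero every column stays below 1 together with c, so none is full and the value is at
    -- most twice the surplus, hence at most 2(1 - δ) = 2 - W.
    sound : ∀ α → A α ≡ false → countAt value S α ℕ.+ W ℕ.≤ 2
    sound α off = ℕtoℚ-cancel-≤ (subst (_≤ ℕtoℚ 2)
      (sym (trans (ℕtoℚ-+ (countAt value S α) W) (cong₂ _+_ (ℕtoℚ-countAt S α) (sym 2δ≡W))))
      (≤-by-balance (+-mono-≤ value≤ (+-mono-≤ (+-mono-≤ c≥0 c≥0) (+-mono-≤ (off-light α off) (off-light α off))))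
        (solve 4 (λ v X c δ → ((X :+ X) :+ ((c :+ c) :+ ((con 1ℚ :- δ) :+ (con 1ℚ :- δ)))) :+ (v :+ (δ :+ δ)) :=
                              (v :+ ((con 0ℚ :+ con 0ℚ) :+ ((c :+ X) :+ (c :+ X)))) :+ con (ℕtoℚ 2)) refl
          (weight (λ i j → ℕtoℚ (value (S i j))) α) (weight x α) c δ)))
      where
      term<1 : ∀ i → c + x i (α i) < 1ℚ
      term<1 i = ≤-<-trans (≤-trans (+-monoʳ-≤ c (term≤sumFin (λ l → x≥0 l (α l)) i))
                                    (≤-trans (off-light α off) 1-δ≤½)) ½<1
      value≤ : weight (λ i j → ℕtoℚ (value (S i j))) α ≤ weight x α + weight x α
      value≤ = subst (weight (λ i j → ℕtoℚ (value (S i j))) α ≤_) (sumFin-+ (λ i → x i (α i)) (λ i → x i (α i)))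
        (sumFin-mono (λ i → value≤-unless-full (graded i (α i)) (x≥0 i (α i)) (term<1 i)))

    -- With value below 2 at most one direction scores, and only a half. All other columns are
    -- small, so `gap-one-large` leaves the index at ½, too light for a one of A.
    score-covers : Covers A (λ i j → value (S i j))
    score-covers β on with 2 ℕ.≤? sum (λ i → value (S i (β i)))
    ... | yes heavy    = heavy
    ... | no not-heavy = ⊥-elim (<-irrefl refl (≤-<-trans (≤-trans (on-heavy β on)
        (gap-one-large c x gap zeros β i₀ (graded-not-full (graded i₀ (β i₀)) (ℕ.≤-<-trans (term≤sum v i₀) light<2))
          (λ l l≢i₀ → graded-none (graded l (β l)) (others l l≢i₀)))) ½<1))
      where
      v : Fin (suc d) → ℕ
      v i = value (S i (β i))
      i₀ = proj₁ (maximiser v)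
      light<2 : sum v ℕ.< 2
      light<2 = ℕ.≰⇒> not-heavy
      others : ∀ l → l ≢ i₀ → v l ≡ 0
      others l l≢i₀ = ℕ.n≤0⇒n≡0 (ℕ.≮⇒≥ λ 0<vl → not-heavy (ℕ.≤-trans
        (ℕ.+-mono-≤ 0<vl (ℕ.<-≤-trans 0<vl (proj₂ (maximiser v) l))) (two-terms≤sum v l≢i₀)))

    -- If X is the total surplus, the cover gives X + n c ≤ n - δ, hence 2X ≤ (1 - c) 2n - 2δ. As c
    -- is nonnegative, 2δ is at least (1 - c) 2δ, and 1 - c cancels.
    score-light : countTotal value S ℕ.+ W ℕ.≤ suc m ℕ.+ suc m
    score-light = ℕtoℚ-cancel-≤ (*-cancelˡ-≤-pos (1ℚ - c) {{positive 0<1-c}} (begin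
      (1ℚ - c) * ℕtoℚ (V ℕ.+ W)
        ≡⟨ cong ((1ℚ - c) *_) (trans (ℕtoℚ-+ V W) (cong (ℕtoℚ V +_) (sym 2δ≡W))) ⟩
      (1ℚ - c) * (ℕtoℚ V + (δ + δ))
        ≤⟨ ≤-by-balance (+-mono-≤ (+-mono-≤ scaled≤ (*-nonNeg c≥0 (+-nonNeg δ≥0 δ≥0))) (+-mono-≤ X≤ X≤))
             (solve 5 (λ c v δ X n →
                (((X :+ X) :+ c :* (δ :+ δ)) :+ ((n :- δ) :+ (n :- δ))) :+ (con 1ℚ :- c) :* (v :+ (δ :+ δ)) :=
                (((con 1ℚ :- c) :* v :+ con 0ℚ) :+ ((X :+ n :* c) :+ (X :+ n :* c))) :+ (con 1ℚ :- c) :* (n :+ n)) refl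
                c (ℕtoℚ V) δ (totalWeight x) N) ⟩
      (1ℚ - c) * (N + N)
        ≡⟨ cong ((1ℚ - c) *_) (ℕtoℚ-+ (suc m) (suc m)) ⟨
      (1ℚ - c) * ℕtoℚ (suc m ℕ.+ suc m) ∎))
      where
      open ≤-Reasoning
      N = ℕtoℚ (suc m)
      V = countTotal value S
      δ≥0 : 0ℚ ≤ δ
      δ≥0 = ≤-trans (nonNegative⁻¹ ½) ½≤δ
      0<1-c : 0ℚ < 1ℚ - c
      0<1-c = subst (_< 1ℚ - c) (+-inverseʳ c) (+-monoˡ-< (- c) (≤-<-trans c≤½ ½<1))
        where
        c≤½ : c ≤ ½
        c≤½ = ≤-trans (subst (_≤ c + weight x α⁰) (+-identityʳ c)
                        (+-monoʳ-≤ c (sumFin-nonNeg (λ i → x≥0 i (α⁰ i)))))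
                      (≤-trans (off-light α⁰ α⁰-off) 1-δ≤½)
      X≤ : totalWeight x + N * c ≤ N - δ
      X≤ = subst (_≤ N - δ) (begin-equality
        totalWeight lam
          ≡⟨ sumFin-cong (λ i → trans
               (sumFin-cong (λ j → solve 2 (λ l u → l := (l :- u) :+ u) refl (lam i j) (μ i)))
               (trans (sumFin-+ (x i) (λ _ → μ i)) (cong (sumFin (suc m) (x i) +_) (sumFin-const (suc m) (μ i))))) ⟩
        sumFin (suc d) (λ i → sumFin (suc m) (x i) + N * μ i)
          ≡⟨ sumFin-+ (λ i → sumFin (suc m) (x i)) (λ i → N * μ i) ⟩
        totalWeight x + sumFin (suc d) (λ i → N * μ i)
          ≡⟨ cong (totalWeight x +_) (sumFin-*ˡ N μ) ⟩
        totalWeight x + N * c ∎) light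
      scaled≤ : (1ℚ - c) * ℕtoℚ V ≤ totalWeight x + totalWeight x
      scaled≤ = begin
        (1ℚ - c) * ℕtoℚ V
          ≡⟨ cong ((1ℚ - c) *_) (trans (ℕtoℚ-sum (λ i → sum (λ j → value (S i j))))
               (sumFin-cong (λ i → ℕtoℚ-sum (λ j → value (S i j))))) ⟩
        (1ℚ - c) * totalWeight (λ i j → ℕtoℚ (value (S i j)))
          ≡⟨ trans (sumFin-cong (λ i → sumFin-*ˡ (1ℚ - c) (λ j → ℕtoℚ (value (S i j)))))
                   (sumFin-*ˡ (1ℚ - c) (λ i → sumFin (suc m) (λ j → ℕtoℚ (value (S i j))))) ⟨
        totalWeight (λ i j → (1ℚ - c) * ℕtoℚ (value (S i j)))
          ≤⟨ sumFin-mono (λ i → sumFin-mono (λ j → scaled-value≤ (graded i j) c≥0 (x≥0 i j))) ⟩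
        totalWeight (λ i j → x i j + x i j)
          ≡⟨ trans (sumFin-cong (λ i → sumFin-+ (x i) (x i)))
                   (sumFin-+ (λ i → sumFin (suc m) (x i)) (λ i → sumFin (suc m) (x i))) ⟩
        totalWeight x + totalWeight x ∎

    scoreCertificate : ScoreCertificate A W
    scoreCertificate = record { S = S ; sound = sound ; covers = score-covers ; light = score-light }

  -- Both deficiencies are treated at once through W = 2δ. The zero α at which a diagonal is sought
  -- also serves as `α⁰` in the rounding.
  half-integral-deficiency : (A : Matrix01 (suc d) (suc m)) {δ : ℚ} {W : ℕ} → δ + δ ≡ ℕtoℚ W → ½ ≤ δ → 1 ℕ.≤ W →
    IsExtremal A → HasDeficiency A δ → IsDiagonallyExtremal A
  half-integral-deficiency A {δ} {W} 2δ≡W ½≤δ 1≤W (no-polydiagonal , maximal) ((K , polyplex , A⊇K) , max) =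
    no-polydiagonal , λ α off →
      score-diagonallyExtremal A W 1≤W
        (Rounding.scoreCertificate A 2δ≡W ½≤δ cover
          (λ β β-off → zero-weight A (<-≤-trans (positive⁻¹ ½) ½≤δ) cover β (maximal β β-off)) α off)
        (half-deficiency-duality A K 2δ≡W polyplex A⊇K) α off
    where cover = fractionalCover A _ max

open import Data.Nat using (_≤_)
open import Data.Rational using (1ℚ; ½)

theorem7p8 : (d m : ℕ) → 1 ≤ d → (A : Matrix01 d (suc m)) →
    IsExtremal A → (HasDeficiency A 1ℚ ⊎ HasDeficiency A ½) →
    IsDiagonallyExtremal A
theorem7p8 (suc d) m _ A extremal (inj₁ deficiency) =
  half-integral-deficiency A {W = 2} refl ½≤1 (ℕ.s≤s ℕ.z≤n) extremal deficiency
theorem7p8 (suc d) m _ A extremal (inj₂ deficiency) =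
  half-integral-deficiency A {W = 1} refl ½≤½ (ℕ.s≤s ℕ.z≤n) extremal deficiency
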